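{- Let $M$ be a binary matroid on ground set $V$ and let $Z$ be a basis of $M$. Then $M\bar{*}V*Z=\mathcal{M}_G$ for some graph $G$ on $V$, and $P_M(y)=(-1)^{\nu(M)}p_1(G)(y)$.
   Context: $M$ is identified with the set system $(V,\mathcal{B})$ of its bases; $\nu(M)=|V|$ minus the rank of $M$. For a set system $N=(V,D)$: twist $N*X=(V,\{Y\triangle X:Y\in D\})$; dual pivot $N\bar{*}X=(V,D'')$ with $Y\in D''$ iff the number of $W\in D$ with $Y\subseteq W\subseteq Y\cup X$ is odd; operations are applied left to right, so $M\bar*V*Z=(M\bar*V)*Z$; $d_N=\min\{|Y|:Y\in D\}$. $P_M(y)=\sum_{X\subseteq V}(-1)^{|X|}y^{d_{M*V\bar{*}X}}$ (for binary matroids this coincides with the Penrose polynomial of Aigner and Mielke). Graphs (loops allowed) are identified with symmetric $V\times V$ adjacency matrices over $\mathrm{GF}(2)$; $\mathcal{M}_G=(V,\{X\subseteq V: G[X]\text{ nonsingular}\})$ with the empty submatrix nonsingular; $p_1(G)(y)=\sum_{X\subseteq V}(-1)^{|X|}y^{d_{\mathcal{M}_G*X}}$. -}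

module Defs where

open import Data.Bool using (Bool; true; false; _∧_; _∨_; not; _xor_; if_then_else_)
open import Data.Nat using (ℕ; zero; suc; _⊔_; _∸_; _≡ᵇ_)
open import Data.Nat as ℕ using ()
open import Data.Integer using (ℤ; +_; -_; _+_; _*_; _^_)
open import Data.Fin using (Fin; zero; suc)
open import Data.Vec using (Vec; []; _∷_; zipWith; replicate; map)
open import Data.List using (List; []; _∷_; _++_; foldr; filter; length)
open import Data.Maybe using (Maybe; just; nothing)
open import Data.Fin.Subset using (Subset; ∣_∣; ⁅_⁆)

allSubsets : (n : ℕ) → List (Subset n)
allSubsets zero = [] ∷ []
allSubsets (suc n) =
  Data.List.map (false ∷_) (allSubsets n) ++ Data.List.map (true ∷_) (allSubsets n)

full : (n : ℕ) → Subset n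
full n = replicate n true

_△_ : ∀ {n} → Subset n → Subset n → Subset n
_△_ = zipWith _xor_

_∪ᵇ_ : ∀ {n} → Subset n → Subset n → Subset n
_∪ᵇ_ = zipWith _∨_

_⊆ᵇ_ : ∀ {n} → Subset n → Subset n → Bool
[] ⊆ᵇ [] = true
(true ∷ ys) ⊆ᵇ (false ∷ ws) = false
(_ ∷ ys) ⊆ᵇ (_ ∷ ws) = ys ⊆ᵇ ws

nonempty : ∀ {n} → Subset n → Bool
nonempty [] = false
nonempty (b ∷ s) = b ∨ nonempty s

allL : ∀ {A : Set} → (A → Bool) → List A → Bool
allL p = foldr (λ x r → p x ∧ r) true

anyL : ∀ {A : Set} → (A → Bool) → List A → Bool
anyL p = foldr (λ x r → p x ∨ r) false

xorSum : ∀ {n} → Subset n → (Fin n → Bool) → Bool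
xorSum [] f = false
xorSum (b ∷ s) f = (b ∧ f zero) xor xorSum s (λ j → f (suc j))

anyIn : ∀ {n} → Subset n → (Fin n → Bool) → Bool
anyIn [] f = false
anyIn (b ∷ s) f = (b ∧ f zero) ∨ anyIn s (λ j → f (suc j))

allOut : ∀ {n} → Subset n → (Fin n → Bool) → Bool
allOut [] f = true
allOut (b ∷ s) f = (b ∨ f zero) ∧ allOut s (λ j → f (suc j))

-- Set systems (V, D) with V = Fin n; D given by its (decidable)
-- membership predicate.

SetSystem : ℕ → Set
SetSystem n = Subset n → Bool

twist : ∀ {n} → SetSystem n → Subset n → SetSystem n
twist D X Y = D (Y △ X)

odd : ℕ → Bool
odd zero = false
odd (suc k) = not (odd k)

dualPivot : ∀ {n} → SetSystem n → Subset n → SetSystem n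
dualPivot {n} D X Y =
  odd (length (filter (λ W → Data.Bool._≟_ ((Y ⊆ᵇ W) ∧ (W ⊆ᵇ (Y ∪ᵇ X)) ∧ D W) true)
                      (allSubsets n)))

minMaybe : Maybe ℕ → ℕ → Maybe ℕ
minMaybe nothing k = just k
minMaybe (just m) k = just (m ℕ.⊓ k)

dmin : ∀ {n} → SetSystem n → Maybe ℕ
dmin {n} D = foldr (λ Y r → if D Y then minMaybe r ∣ Y ∣ else r) nothing (allSubsets n)

-- rank = max {|Y| : Y ∈ D}  (for a matroid: the common size of its bases)
rankSS : ∀ {n} → SetSystem n → ℕ
rankSS {n} D = foldr (λ Y r → if D Y then ∣ Y ∣ ⊔ r else r) 0 (allSubsets n)

nullity : ∀ {n} → SetSystem n → ℕ
nullity {n} M = n ∸ rankSS M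

-- Binary matroids: column matroids of GF(2) matrices (GF(2) = Bool,
-- addition = xor, multiplication = ∧).

Matrix₂ : ℕ → ℕ → Set
Matrix₂ k n = Fin k → Fin n → Bool

-- Columns indexed by X are linearly independent over GF(2):
-- no nonempty S ⊆ X has columns summing to zero.
colIndep : ∀ {k n} → Matrix₂ k n → Subset n → Bool
colIndep {k} {n} A X =
  allL (λ S → not ((S ⊆ᵇ X) ∧ nonempty S)
              ∨ anyL (λ i → xorSum S (A i)) (allFinL k))
       (allSubsets n)
  where
  allFinL : (m : ℕ) → List (Fin m)
  allFinL m = Data.List.allFin m

colBasis : ∀ {k n} → Matrix₂ k n → SetSystem n
colBasis A X = colIndep A X ∧ allOut X (λ j → not (colIndep A (X ∪ᵇ ⁅ j ⁆)))

IsBinaryMatroid : ∀ {n} → SetSystem n → Set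
IsBinaryMatroid {n} M =
  Data.Product.Σ ℕ λ k → Data.Product.Σ (Matrix₂ k n) λ A →
    ∀ X → M X Relation.Binary.PropositionalEquality.≡ colBasis A X
  where
  import Data.Product
  import Relation.Binary.PropositionalEquality

-- Graphs (loops allowed) = symmetric GF(2) matrices V × V.

Graph : ℕ → Set
Graph n = Fin n → Fin n → Bool

-- G[X] is nonsingular over GF(2): no nonzero vector supported on X
-- is in its kernel (for X = ∅ this holds vacuously).
nonsingularSub : ∀ {n} → Graph n → Subset n → Bool
nonsingularSub {n} G X =
  allL (λ S → not ((S ⊆ᵇ X) ∧ nonempty S) ∨ anyIn X (λ i → xorSum S (G i)))
       (allSubsets n)

MG : ∀ {n} → Graph n → SetSystem n
MG G = nonsingularSub G

-- Polynomials in y with integer coefficients, as coefficient sequences.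

Poly : Set
Poly = ℕ → ℤ

-- y^d  (and 0 for the convention y^{d_N} = 0 when D = ∅)
yPow : Maybe ℕ → Poly
yPow nothing j = + 0
yPow (just d) j = if d ≡ᵇ j then + 1 else + 0

sumL : ∀ {A : Set} → (A → ℤ) → List A → ℤ
sumL f = foldr (λ x r → f x + r) (+ 0)

sgn : ℕ → ℤ
sgn k = (- (+ 1)) ^ k

penrose : ∀ {n} → SetSystem n → Poly
penrose {n} M j =
  sumL (λ X → sgn ∣ X ∣ * yPow (dmin (dualPivot (twist M (full n)) X)) j) (allSubsets n)

p1 : ∀ {n} → Graph n → Poly
p1 {n} G j =
  sumL (λ X → sgn ∣ X ∣ * yPow (dmin (twist (MG G) X)) j) (allSubsets n)

{-# OPTIONS --safe #-}
module Submission where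

-- Let L be the row space of a matrix representing M, and L⊥ its cycle space. A set Y is a basis
-- iff no nonzero (x , u) in L × L⊥ satisfies x = 0 on Y and u = 0 off Y. In coordinates given by
-- the basis Z this says that a square system, with one row x v or u v for each v, is nonsingular.
-- Over GF(2) nonsingularity is additive in each row, so the dual pivot on V replaces the
-- condition u = 0 off Y by x + u = 0; a shear of the coordinates turns the new rows into those of
-- a symmetric matrix G. For the polynomials, M*V pivoted on X and (M pivoted on V) twisted by
-- V∖X differ by a loop complementation on V, which preserves the minimum size of a feasible set.

open import Defs
open import Data.Nat using (ℕ; zero; suc; _<_; _≤_; s≤s; z≤n)
import Data.Nat as ℕ
import Data.Nat.Properties as ℕ
open import Data.Bool using (Bool; true; false; _∧_; _∨_; not; _xor_; if_then_else_)
import Data.Bool as Bool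
import Data.Bool.Properties as Bool
open import Data.Bool.Solver using (module xor-∧-Solver)
open import Data.Integer using (ℤ; _+_; _*_; -1ℤ)
import Data.Integer.Properties as ℤ
open import Data.Integer.Solver using (module +-*-Solver)
open import Data.Fin using (Fin; zero; suc)
import Data.Fin as Fin
import Data.Fin.Properties as Fin
open import Data.Product using (Σ; _×_; _,_; ∃; proj₁; proj₂)
open import Data.Sum using (_⊎_; inj₁; inj₂)
open import Data.Maybe using (Maybe; just; nothing)
open import Data.Empty using (⊥-elim)
open import Data.Vec using (Vec; []; _∷_; lookup; tabulate; _[_]≔_)
import Data.Vec as Vec
import Data.Vec.Properties as Vec
open import Data.List using (List; []; _∷_)
import Data.List as List
import Data.List.Membership.Propositional as List
import Data.List.Membership.Propositional.Properties as List
open import Data.List.Relation.Unary.Any using (here; there)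
open import Function using (case_of_)
open import Data.Fin.Subset using (Subset; ⊥; ⊤; ⁅_⁆; _∈_; _∩_; _-_; ∁; ∣_∣)
import Data.Fin.Subset.Properties as Sub
open import Relation.Nullary using (yes; no)
open import Relation.Nullary.Decidable using (_×-dec_)
open import Relation.Binary.PropositionalEquality using (_≡_; _≢_; refl; sym; trans; cong; cong₂; subst; module ≡-Reasoning)

-- The system is square because `L × L⊥` has dimension r + (n - r) = n. Its two kinds of conditions
-- are the two halves of being a basis: a cycle inside `Y` must vanish (independence) and a cocycle
-- avoiding `Y` must vanish (spanning). Nonsingularity is triviality of a kernel throughout. No
-- determinant is at hand to supply multilinearity, so additivity in a row is obtained by counting
-- dimensions. The twist by `Z` selects a good origin: the rows x on `Z` and x + u off `Z` are
-- unitriangular in the coordinates given by `Z`, so their values can serve as new coordinates, and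
-- the remaining rows written in them are the rows of G. The symmetry of G is the orthogonality of
-- cycles and cocycles: the form pairing the x of one pair with the u of another vanishes on
-- `L × L⊥`, and the passage to the new coordinates and rows preserves this form at every v.

private
  variable
    n k : ℕ

-- Linear algebra over GF(2)

abstract
  xor-interchange : ∀ a b c d → (a xor b) xor (c xor d) ≡ (a xor c) xor (b xor d)
  xor-interchange = solve 4 (λ a b c d → (a :+ b) :+ (c :+ d) := (a :+ c) :+ (b :+ d)) refl
    where open xor-∧-Solver

if-false : ∀ b {a c : Bool} → (b ≡ true → a ≡ false) → (b ≡ false → c ≡ false) → (if b then a else c) ≡ false
if-false true f g = f refl
if-false false f g = g refl

xor≡false⇒≡ : ∀ a b → a xor b ≡ false → a ≡ b
xor≡false⇒≡ false false _ = refl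
xor≡false⇒≡ true true _ = refl

≡true-ext : ∀ {a b} → (a ≡ true → b ≡ true) → (b ≡ true → a ≡ true) → a ≡ b
≡true-ext {false} {false} f g = refl
≡true-ext {false} {true} f g = g refl
≡true-ext {true} {b} f g = sym (f refl)

lookup-ext : ∀ {A : Set} {p q : Vec A n} → (∀ i → lookup p i ≡ lookup q i) → p ≡ q
lookup-ext {p = p} {q} h =
  trans (sym (Vec.tabulate∘lookup p)) (trans (Vec.tabulate-cong h) (Vec.tabulate∘lookup q))

lookup-⊥ : ∀ (i : Fin n) → lookup ⊥ i ≡ false
lookup-⊥ i = Vec.lookup-replicate i false

lookup-△ : ∀ (p q : Subset n) i → lookup (p △ q) i ≡ lookup p i xor lookup q i
lookup-△ p q i = Vec.lookup-zipWith _xor_ i p q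

△-identityˡ : ∀ (p : Subset n) → ⊥ △ p ≡ p
△-identityˡ [] = refl
△-identityˡ (b ∷ p) = cong (b ∷_) (△-identityˡ p)

△-self : ∀ (p : Subset n) → p △ p ≡ ⊥
△-self [] = refl
△-self (b ∷ p) = cong₂ _∷_ (Bool.xor-same b) (△-self p)

△≡⊥⇒≡ : ∀ (p q : Subset n) → p △ q ≡ ⊥ → p ≡ q
△≡⊥⇒≡ p q e = lookup-ext λ i → xor≡false⇒≡ _ _
  (trans (sym (lookup-△ p q i)) (trans (cong (λ r → lookup r i) e) (lookup-⊥ i)))

△-assoc : ∀ (p q r : Subset n) → (p △ q) △ r ≡ p △ (q △ r)
△-assoc [] [] [] = refl
△-assoc (a ∷ p) (b ∷ q) (c ∷ r) = cong₂ _∷_ (Bool.xor-assoc a b c) (△-assoc p q r)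

lookup-⁅⁆ : ∀ (i : Fin n) → lookup ⁅ i ⁆ i ≡ true
lookup-⁅⁆ i = Vec.[]=⇒lookup (Sub.x∈⁅x⁆ i)

lookup-⁅⁆-≢ : ∀ {i j : Fin n} → i ≢ j → lookup ⁅ j ⁆ i ≡ false
lookup-⁅⁆-≢ {i = i} {j} i≢j = Bool.¬-not λ e → Sub.x≢y⇒x∉⁅y⁆ i≢j (Vec.lookup⇒[]= i ⁅ j ⁆ e)

∣++∣ : ∀ {m} (p : Subset m) (q : Subset n) → ∣ p Vec.++ q ∣ ≡ ∣ p ∣ ℕ.+ ∣ q ∣
∣++∣ [] q = refl
∣++∣ (false ∷ p) q = ∣++∣ p q
∣++∣ (true ∷ p) q = cong suc (∣++∣ p q)

Form : ℕ → Set
Form n = Subset n → Bool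

record Additive (φ : Form n) : Set where
  constructor additive
  field homo : ∀ p q → φ (p △ q) ≡ φ p xor φ q

open Additive

additive-⊥ : ∀ {φ : Form n} → Additive φ → φ ⊥ ≡ false
additive-⊥ {φ = φ} add = begin
  φ ⊥             ≡⟨ cong φ (△-self ⊥) ⟨
  φ (⊥ △ ⊥)       ≡⟨ homo add ⊥ ⊥ ⟩
  φ ⊥ xor φ ⊥     ≡⟨ Bool.xor-same (φ ⊥) ⟩
  false           ∎
  where open ≡-Reasoning

additive-tail : ∀ {φ : Form (suc n)} → Additive φ → Additive (λ p → φ (false ∷ p))
additive-tail add = additive λ p q → homo add (false ∷ p) (false ∷ q)

additive-∷ : ∀ {φ : Form (suc n)} → Additive φ → ∀ b p →
             φ (b ∷ p) ≡ (b ∧ φ (true ∷ ⊥)) xor φ (false ∷ p)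
additive-∷ add false p = refl
additive-∷ {φ = φ} add true p =
  trans (cong (λ r → φ (true ∷ r)) (sym (△-identityˡ p))) (homo add (true ∷ ⊥) (false ∷ p))

additive-xor : ∀ {φ ψ : Form n} → Additive φ → Additive ψ → Additive (λ p → φ p xor ψ p)
additive-xor {φ = φ} {ψ} f g = additive λ p q →
  trans (cong₂ _xor_ (homo f p q) (homo g p q)) (xor-interchange (φ p) (φ q) (ψ p) (ψ q))

additive-∧ : ∀ {φ : Form n} b → Additive φ → Additive (λ p → b ∧ φ p)
additive-∧ false f = additive λ p q → refl
additive-∧ true f = additive (homo f)

additive-lookup : ∀ (i : Fin n) → Additive (λ p → lookup p i)
additive-lookup i = additive λ p q → lookup-△ p q i

xorSum-△ : ∀ (f : Fin n → Bool) p q → xorSum (p △ q) f ≡ xorSum p f xor xorSum q f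
xorSum-△ f [] [] = refl
xorSum-△ f (a ∷ p) (b ∷ q) = trans
  (cong₂ _xor_ (Bool.∧-distribʳ-xor (f zero) a b) (xorSum-△ (λ j → f (suc j)) p q))
  (xor-interchange (a ∧ f zero) (b ∧ f zero) _ _)

additive-xorSum : ∀ (f : Fin n → Bool) → Additive (λ S → xorSum S f)
additive-xorSum f = additive (xorSum-△ f)

additive-expand : ∀ {φ : Form n} → Additive φ → ∀ p → φ p ≡ xorSum p (λ j → φ ⁅ j ⁆)
additive-expand {φ = φ} add [] = additive-⊥ add
additive-expand {φ = φ} add (b ∷ p) =
  trans (additive-∷ add b p)
        (cong ((b ∧ φ (true ∷ ⊥)) xor_) (additive-expand (additive-tail add) p))

xorSum-cong-on : ∀ (S : Subset n) {f g : Fin n → Bool} →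
  (∀ i → lookup S i ≡ true → f i ≡ g i) → xorSum S f ≡ xorSum S g
xorSum-cong-on [] h = refl
xorSum-cong-on (false ∷ S) h = xorSum-cong-on S (λ i → h (suc i))
xorSum-cong-on (true ∷ S) h = cong₂ _xor_ (h zero refl) (xorSum-cong-on S (λ i → h (suc i)))

xorSum-cong : ∀ (S : Subset n) {f g : Fin n → Bool} →
  (∀ i → f i ≡ g i) → xorSum S f ≡ xorSum S g
xorSum-cong S h = xorSum-cong-on S (λ i _ → h i)

xorSum-false : ∀ (S : Subset n) → xorSum S (λ _ → false) ≡ false
xorSum-false [] = refl
xorSum-false (b ∷ S) = cong₂ _xor_ (Bool.∧-zeroʳ b) (xorSum-false S)

xorSum-xor : ∀ (S : Subset n) (f g : Fin n → Bool) →
  xorSum S (λ i → f i xor g i) ≡ xorSum S f xor xorSum S g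
xorSum-xor [] f g = refl
xorSum-xor (b ∷ S) f g = trans
  (cong₂ _xor_ (Bool.∧-distribˡ-xor b (f zero) (g zero)) (xorSum-xor S (λ j → f (suc j)) (λ j → g (suc j))))
  (xor-interchange (b ∧ f zero) _ _ _)

xorSum-⁅⁆ : ∀ (i : Fin n) f → xorSum ⁅ i ⁆ f ≡ f i
xorSum-⁅⁆ zero f = trans (cong (f zero xor_) (additive-⊥ (additive-xorSum (λ j → f (suc j))))) (Bool.xor-identityʳ (f zero))
xorSum-⁅⁆ (suc i) f = xorSum-⁅⁆ i (λ j → f (suc j))

xorSum-full : ∀ (S : Subset n) f → xorSum S f ≡ xorSum (full n) (λ i → lookup S i ∧ f i)
xorSum-full [] f = refl
xorSum-full (b ∷ S) f = cong ((b ∧ f zero) xor_) (xorSum-full S (λ j → f (suc j)))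

xorSum-comm : ∀ (p q : Subset n) → xorSum p (lookup q) ≡ xorSum q (lookup p)
xorSum-comm [] [] = refl
xorSum-comm (a ∷ p) (b ∷ q) = cong₂ _xor_ (Bool.∧-comm a b) (xorSum-comm p q)

additive-vanish : ∀ {φ : Form n} → Additive φ → (∀ j → φ ⁅ j ⁆ ≡ false) → ∀ p → φ p ≡ false
additive-vanish add h p =
  trans (additive-expand add p) (trans (xorSum-cong p h) (xorSum-false p))

-- Gaussian elimination on the first coordinate. Either all forms in `S` vanish at the first unit
-- vector, or some `φ i` does not; then `φ i` is used to clear the first coordinate from the others
-- and is dropped from `S`. Selecting the forms by a subset allows one to be dropped without
-- reindexing the family.
common-zero : ∀ n (φ : Fin k → Form n) → (∀ i → Additive (φ i)) → (S : Subset k) → ∣ S ∣ < n →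
  ∃ λ p → p ≢ ⊥ × (∀ i → i ∈ S → φ i p ≡ false)
common-zero (suc n) φ add S lt
  with Fin.any? (λ i → (i Sub.∈? S) ×-dec (φ i (true ∷ ⊥) Bool.≟ true))
... | no none = (true ∷ ⊥) , (λ ()) , λ i i∈S → Bool.¬-not (λ e → none (i , i∈S , e))
-- The first coordinate is the value that makes `φ i` vanish, since `φ i` has coefficient `true`
-- there.
... | yes (i , i∈S , φi≡true) = (φ i (false ∷ p) ∷ p) , p≢⊥′ , vanish
  where
  ψ : Fin _ → Form n
  ψ l p = φ l (false ∷ p) xor (φ l (true ∷ ⊥) ∧ φ i (false ∷ p))

  ih = common-zero n ψ
         (λ l → additive-xor (additive-tail (add l)) (additive-∧ (φ l (true ∷ ⊥)) (additive-tail (add i))))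
         (S - i) (ℕ.<-≤-trans (Sub.x∈p⇒∣p-x∣<∣p∣ i∈S) (ℕ.≤-pred lt))
  p = proj₁ ih

  p≢⊥′ : (φ i (false ∷ p) ∷ p) ≢ ⊥
  p≢⊥′ e = proj₁ (proj₂ ih) (cong Vec.tail e)

  expand : ∀ l → φ l (φ i (false ∷ p) ∷ p) ≡ ψ l p
  expand l = trans (additive-∷ (add l) (φ i (false ∷ p)) p)
    (trans (Bool.xor-comm (φ i (false ∷ p) ∧ _) _) (cong (φ l (false ∷ p) xor_) (Bool.∧-comm (φ i (false ∷ p)) _)))

  vanish : ∀ l → l ∈ S → φ l (φ i (false ∷ p) ∷ p) ≡ false
  vanish l l∈S with l Fin.≟ i
  ... | no l≢i = trans (expand l) (proj₂ (proj₂ ih) l (Sub.x∈p∧x≢y⇒x∈p-y l∈S l≢i))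
  ... | yes refl = trans (expand l)
    (trans (cong (λ b → φ l (false ∷ p) xor (b ∧ φ l (false ∷ p))) φi≡true) (Bool.xor-same (φ l (false ∷ p))))

-- Boolean reflection

∈-allSubsets : ∀ (S : Subset n) → S List.∈ allSubsets n
∈-allSubsets [] = here refl
∈-allSubsets (false ∷ S) = List.∈-++⁺ˡ (List.∈-map⁺ (false ∷_) (∈-allSubsets S))
∈-allSubsets (true ∷ S) = List.∈-++⁺ʳ _ (List.∈-map⁺ (true ∷_) (∈-allSubsets S))

allL-lookup : ∀ {A : Set} {p : A → Bool} {xs x} → allL p xs ≡ true → x List.∈ xs → p x ≡ true
allL-lookup {p = p} {x = x} h (here refl) with p x
... | true = refl
allL-lookup {p = p} {xs = y ∷ _} h (there x∈xs) with p y
... | true = allL-lookup h x∈xs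

allL-tabulate : ∀ {A : Set} {p : A → Bool} xs → (∀ x → p x ≡ true) → allL p xs ≡ true
allL-tabulate [] h = refl
allL-tabulate (x ∷ xs) h = cong₂ _∧_ (h x) (allL-tabulate xs h)

allL-counterexample : ∀ {A : Set} {p : A → Bool} xs → allL p xs ≡ false → ∃ λ x → p x ≡ false
allL-counterexample {p = p} (x ∷ xs) h with p x in eq
... | false = x , eq
... | true = allL-counterexample xs h

anyL-none : ∀ {A : Set} {p : A → Bool} {xs x} → anyL p xs ≡ false → x List.∈ xs → p x ≡ false
anyL-none {p = p} {x = x} h (here refl) with p x
... | false = refl
anyL-none {p = p} {xs = y ∷ _} h (there x∈xs) with p y
... | false = anyL-none h x∈xs

anyL-all-false : ∀ {A : Set} {p : A → Bool} xs → (∀ x → p x ≡ false) → anyL p xs ≡ false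
anyL-all-false [] h = refl
anyL-all-false (x ∷ xs) h = cong₂ _∨_ (h x) (anyL-all-false xs h)

anyIn-none : ∀ (X : Subset n) {f} → anyIn X f ≡ false → ∀ i → lookup X i ≡ true → f i ≡ false
anyIn-none (true ∷ X) {f} h zero refl with f zero
... | false = refl
anyIn-none (b ∷ X) {f} h (suc i) i∈X with b ∧ f zero
... | false = anyIn-none X h i i∈X

anyIn-all-false : ∀ (X : Subset n) {f} → (∀ i → lookup X i ≡ true → f i ≡ false) → anyIn X f ≡ false
anyIn-all-false [] h = refl
anyIn-all-false (false ∷ X) h = anyIn-all-false X (λ i → h (suc i))
anyIn-all-false (true ∷ X) h = cong₂ _∨_ (h zero refl) (anyIn-all-false X (λ i → h (suc i)))

allOut-lookup : ∀ (X : Subset n) {f} → allOut X f ≡ true → ∀ i → lookup X i ≡ false → f i ≡ true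
allOut-lookup (false ∷ X) {f} h zero refl with f zero
... | true = refl
allOut-lookup (b ∷ X) {f} h (suc i) i∉X with b ∨ f zero
... | true = allOut-lookup X h i i∉X

allOut-tabulate : ∀ (X : Subset n) {f} → (∀ i → lookup X i ≡ false → f i ≡ true) → allOut X f ≡ true
allOut-tabulate [] h = refl
allOut-tabulate (true ∷ X) h = allOut-tabulate X (λ i → h (suc i))
allOut-tabulate (false ∷ X) h = cong₂ _∧_ (h zero refl) (allOut-tabulate X (λ i → h (suc i)))

-- Containment is phrased as vanishing off `X`, the form in which it is exchanged with the row
-- conditions.
_⊑_ : Subset n → Subset n → Set
S ⊑ X = ∀ i → lookup X i ≡ false → lookup S i ≡ false

⊆ᵇ⇒⊑ : ∀ (S X : Subset n) → S ⊆ᵇ X ≡ true → S ⊑ X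
⊆ᵇ⇒⊑ (false ∷ S) (false ∷ X) h zero _ = refl
⊆ᵇ⇒⊑ (false ∷ S) (b ∷ X) h (suc i) = ⊆ᵇ⇒⊑ S X h i
⊆ᵇ⇒⊑ (true ∷ S) (true ∷ X) h (suc i) = ⊆ᵇ⇒⊑ S X h i

⊑⇒⊆ᵇ : ∀ (S X : Subset n) → S ⊑ X → S ⊆ᵇ X ≡ true
⊑⇒⊆ᵇ [] [] h = refl
⊑⇒⊆ᵇ (false ∷ S) (b ∷ X) h = ⊑⇒⊆ᵇ S X (λ i → h (suc i))
⊑⇒⊆ᵇ (true ∷ S) (true ∷ X) h = ⊑⇒⊆ᵇ S X (λ i → h (suc i))
⊑⇒⊆ᵇ (true ∷ S) (false ∷ X) h with () ← h zero refl

nonempty-⊥ : ∀ n → nonempty (⊥ {n}) ≡ false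
nonempty-⊥ zero = refl
nonempty-⊥ (suc n) = nonempty-⊥ n

empty⇒⊥ : ∀ (S : Subset n) → nonempty S ≡ false → S ≡ ⊥
empty⇒⊥ [] h = refl
empty⇒⊥ (false ∷ S) h = cong (false ∷_) (empty⇒⊥ S h)

-- The common shape of linear independence and nonsingularity: no nonempty S ⊆ X has g S ≡ false.
trivialOn : Subset n → Form n → Bool
trivialOn {n} X g = allL (λ S → not ((S ⊆ᵇ X) ∧ nonempty S) ∨ g S) (allSubsets n)

trivialOn-elim : ∀ {X : Subset n} {g} → trivialOn X g ≡ true → ∀ S → S ⊑ X → g S ≡ false → S ≡ ⊥
trivialOn-elim {X = X} h S S⊑X gS with nonempty S in eq | allL-lookup h (∈-allSubsets S)
... | false | _ = empty⇒⊥ S eq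
... | true | e rewrite ⊑⇒⊆ᵇ S X S⊑X | gS with () ← e

trivialOn-intro : ∀ {X : Subset n} {g} → (∀ S → S ⊑ X → g S ≡ false → S ≡ ⊥) → trivialOn X g ≡ true
trivialOn-intro {n} {X} {g} h = allL-tabulate (allSubsets n) check
  where
  check : ∀ S → not ((S ⊆ᵇ X) ∧ nonempty S) ∨ g S ≡ true
  check S with S ⊆ᵇ X in S⊆X | g S in gS
  ... | false | _ = refl
  ... | true | true = Bool.∨-zeroʳ _
  ... | true | false rewrite h S (⊆ᵇ⇒⊑ S X S⊆X) gS | nonempty-⊥ n = refl

trivialOn-counterexample : ∀ {X : Subset n} {g} → trivialOn X g ≡ false →
  ∃ λ S → S ⊑ X × g S ≡ false × S ≢ ⊥
trivialOn-counterexample {n} {X} {g} h with allL-counterexample (allSubsets n) h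
... | S , e with S ⊆ᵇ X in S⊆X | nonempty S in ne | g S in gS
... | true | true | false =
  S , ⊆ᵇ⇒⊑ S X S⊆X , gS , λ { refl → case (trans (sym ne) (nonempty-⊥ n)) of λ () }

-- Nonsingularity of a square system is additive in each row

-- The three nonzero linear forms on the pair (x v , u v): x, u and their sum.
data Label : Set where
  α β γ : Label

select : Label → Label → Subset n → Vec Label n
select a b = Vec.map (if_then a else b)

module Rows {n} (x u : Fin n → Form n)
            (x-additive : ∀ i → Additive (x i)) (u-additive : ∀ i → Additive (u i)) where

  row : Label → Fin n → Form n
  row α i p = x i p
  row β i p = u i p
  row γ i p = x i p xor u i p

  row-additive : ∀ c i → Additive (row c i)
  row-additive α i = x-additive i
  row-additive β i = u-additive i
  row-additive γ i = additive-xor (x-additive i) (u-additive i)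

  nonsingular : Vec Label n → Bool
  nonsingular t = trivialOn (full n) (λ p → anyL (λ i → row (lookup t i) i p) (List.allFin n))

  nonsingular-elim : ∀ t → nonsingular t ≡ true →
    ∀ p → (∀ i → row (lookup t i) i p ≡ false) → p ≡ ⊥
  nonsingular-elim t h p zeros = trivialOn-elim h p
    (λ i i∉ → case (trans (sym (Vec.lookup-replicate i true)) i∉) of λ ())
    (anyL-all-false (List.allFin n) zeros)

  nonsingular-intro : ∀ t → (∀ p → (∀ i → row (lookup t i) i p ≡ false) → p ≡ ⊥) →
    nonsingular t ≡ true
  nonsingular-intro t h = trivialOn-intro λ p _ e → h p λ i → anyL-none e (List.∈-allFin i)

  -- The n - 1 rows other than that of `v` are too few to determine a vector of length n.
  zero-off : ∀ (v : Fin n) (t : Vec Label n) →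
    ∃ λ p → p ≢ ⊥ × (∀ i → i ≢ v → row (lookup t i) i p ≡ false)
  zero-off v t
    with common-zero n (λ i → row (lookup t i) i) (λ i → row-additive (lookup t i) i) (⊤ - v)
           (subst (∣ ⊤ - v ∣ <_) (Sub.∣⊤∣≡n n) (Sub.x∈p⇒∣p-x∣<∣p∣ (Sub.∈⊤ {x = v})))
  ... | p , p≢⊥ , zeros = p , p≢⊥ , λ i i≢v → zeros i (Sub.x∈p∧x≢y⇒x∈p-y Sub.∈⊤ i≢v)

  module _ (v : Fin n) (t : Vec Label n) where

    OffZero : Subset n → Set
    OffZero p = ∀ i → i ≢ v → row (lookup t i) i p ≡ false

    update-zero : ∀ c {p} → OffZero p → row c v p ≡ false →
      ∀ i → row (lookup (t [ v ]≔ c) i) i p ≡ false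
    update-zero c {p} off cv i with i Fin.≟ v
    ... | yes refl = trans (cong (λ d → row d i p) (Vec.lookup∘update i t c)) cv
    ... | no i≢v = trans (cong (λ d → row d i p) (Vec.lookup∘update′ i≢v t c)) (off i i≢v)

    update-zero⁻ : ∀ c {p} → (∀ i → row (lookup (t [ v ]≔ c) i) i p ≡ false) →
      OffZero p × row c v p ≡ false
    update-zero⁻ c {p} zeros =
      (λ i i≢v → trans (cong (λ d → row d i p) (sym (Vec.lookup∘update′ i≢v t c))) (zeros i)) ,
      trans (cong (λ d → row d v p) (sym (Vec.lookup∘update v t c))) (zeros v)

    module _ {k} (k≢⊥ : k ≢ ⊥) (off : OffZero k) where

      singular : ∀ c → row c v k ≡ false → nonsingular (t [ v ]≔ c) ≡ false
      singular c ck = Bool.¬-not λ ns → k≢⊥ (nonsingular-elim (t [ v ]≔ c) ns k (update-zero c off ck))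

      -- Let `p` be a zero of the system with row `d`. If row `c` vanishes at `p`, then `p` is a
      -- zero of the system with row `c`. Otherwise `c` is `true` at both `p` and `k`, so `p △ k` is
      -- such a zero; hence `p` equals `k`, which contradicts `dk`.
      transfer : ∀ c d → row c v k ≡ true → row d v k ≡ true →
        nonsingular (t [ v ]≔ c) ≡ true → nonsingular (t [ v ]≔ d) ≡ true
      transfer c d ck dk ns = nonsingular-intro (t [ v ]≔ d) step
        where
        step : ∀ p → (∀ i → row (lookup (t [ v ]≔ d) i) i p ≡ false) → p ≡ ⊥
        step p zeros with row c v p in cp | update-zero⁻ d zeros
        ... | false | offp , dp = nonsingular-elim (t [ v ]≔ c) ns p (update-zero c offp cp)
        ... | true | offp , dp = case trans (sym dk) (trans (cong (row d v) (sym p≡k)) dp) of λ ()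
          where
          p≡k : p ≡ k
          p≡k = △≡⊥⇒≡ p k (nonsingular-elim (t [ v ]≔ c) ns (p △ k) (update-zero c
            (λ i i≢v → trans (homo (row-additive (lookup t i) i) p k) (cong₂ _xor_ (offp i i≢v) (off i i≢v)))
            (trans (homo (row-additive c v) p k) (cong₂ _xor_ cp ck))))

      same : ∀ c d → row c v k ≡ true → row d v k ≡ true →
        nonsingular (t [ v ]≔ c) ≡ nonsingular (t [ v ]≔ d)
      same c d ck dk = ≡true-ext (transfer c d ck dk) (transfer d c dk ck)

  -- A nonzero common zero k of the other rows decides everything: a row vanishing at k
  -- makes the system singular, and all rows not vanishing at k are equivalent.
  nonsingular-xor : ∀ v t →
    nonsingular (t [ v ]≔ α) xor nonsingular (t [ v ]≔ β) ≡ nonsingular (t [ v ]≔ γ)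
  nonsingular-xor v t with zero-off v t
  ... | k , k≢⊥ , off with x v k in xk | u v k in uk
  ... | false | false = trans
    (cong₂ _xor_ (singular v t k≢⊥ off α xk) (singular v t k≢⊥ off β uk))
    (sym (singular v t k≢⊥ off γ (cong₂ _xor_ xk uk)))
  ... | false | true = trans
    (cong (_xor nonsingular (t [ v ]≔ β)) (singular v t k≢⊥ off α xk))
    (same v t k≢⊥ off β γ uk (cong₂ _xor_ xk uk))
  ... | true | false = trans
    (cong (nonsingular (t [ v ]≔ α) xor_) (singular v t k≢⊥ off β uk))
    (trans (Bool.xor-identityʳ _) (same v t k≢⊥ off α γ xk (cong₂ _xor_ xk uk)))
  ... | true | true = trans
    (cong (_xor nonsingular (t [ v ]≔ β)) (same v t k≢⊥ off α β xk uk))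
    (trans (Bool.xor-same (nonsingular (t [ v ]≔ β))) (sym (singular v t k≢⊥ off γ (cong₂ _xor_ xk uk))))

-- Column matroids

module _ {k n} (B : Matrix₂ k n) where

  Dependency : Subset n → Set
  Dependency S = ∀ i → xorSum S (B i) ≡ false

  colIndep-elim : ∀ {X} → colIndep B X ≡ true → ∀ S → S ⊑ X → Dependency S → S ≡ ⊥
  colIndep-elim h S S⊑X dep = trivialOn-elim h S S⊑X (anyL-all-false (List.allFin k) dep)

  colIndep-intro : ∀ {X} → (∀ S → S ⊑ X → Dependency S → S ≡ ⊥) → colIndep B X ≡ true
  colIndep-intro h = trivialOn-intro λ S S⊑X e → h S S⊑X λ i → anyL-none e (List.∈-allFin i)

  colIndep-counterexample : ∀ {X} → colIndep B X ≡ false → ∃ λ S → S ⊑ X × Dependency S × S ≢ ⊥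
  colIndep-counterexample h with trivialOn-counterexample h
  ... | S , S⊑X , e , S≢⊥ = S , S⊑X , (λ i → anyL-none e (List.∈-allFin i)) , S≢⊥

  Dependency-△ : ∀ {S T} → Dependency S → Dependency T → Dependency (S △ T)
  Dependency-△ {S} {T} s t i = trans (xorSum-△ (B i) S T) (cong₂ _xor_ (s i) (t i))

  ∪ᵇ-⁅⁆-out : ∀ (X : Subset n) j i → lookup X i ≡ false → i ≢ j → lookup (X ∪ᵇ ⁅ j ⁆) i ≡ false
  ∪ᵇ-⁅⁆-out X j i i∉X i≢j = trans (Vec.lookup-zipWith _∨_ i X ⁅ j ⁆) (cong₂ _∨_ i∉X (lookup-⁅⁆-≢ i≢j))

  ⊑-∪ᵇ-⁅⁆ : ∀ (S X : Subset n) j → S ⊑ (X ∪ᵇ ⁅ j ⁆) → lookup S j ≡ false → S ⊑ X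
  ⊑-∪ᵇ-⁅⁆ S X j S⊑ j∉S i i∉X with i Fin.≟ j
  ... | yes refl = j∉S
  ... | no i≢j = S⊑ i (∪ᵇ-⁅⁆-out X j i i∉X i≢j)

  module _ {X} (basis : colBasis B X ≡ true) where

    basis⇒indep : colIndep B X ≡ true
    basis⇒indep with colIndep B X
    ... | true = refl

    basis⇒maximal : ∀ j → lookup X j ≡ false → colIndep B (X ∪ᵇ ⁅ j ⁆) ≡ false
    basis⇒maximal j j∉X with colIndep B X
    ... | true = Bool.not-injective (allOut-lookup X basis j j∉X)

    -- Maximality supplies a nonempty dependency inside `X` with `j` added; it contains `j`, or it
    -- would lie in the independent set `X`.
    circuit : ∀ j → lookup X j ≡ false →
      ∃ λ S → S ⊑ (X ∪ᵇ ⁅ j ⁆) × Dependency S × lookup S j ≡ true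
    circuit j j∉X with colIndep-counterexample (basis⇒maximal j j∉X)
    ... | S , S⊑ , dep , S≢⊥ with lookup S j in Sj
    ... | true = S , S⊑ , dep , Sj
    ... | false = ⊥-elim (S≢⊥ (colIndep-elim basis⇒indep S (⊑-∪ᵇ-⁅⁆ S X j S⊑ Sj) dep))

-- p parametrises a pair (x p , u p) of a cocycle and a cycle: x p is the cocycle that agrees
-- with p on Z, and u p is the cycle that agrees with p off Z.
module Coordinates {k n} (B : Matrix₂ k n) (Z : Subset n) (Z-basis : colBasis B Z ≡ true) where

  abstract
    -- The fundamental circuit of `j` with respect to `Z`. The empty set is used for `j` in `Z`, so
    -- that `u` reads only the coordinates off `Z`.
    fundamental : ∀ b j → lookup Z j ≡ b → Subset n
    fundamental true j _ = ⊥
    fundamental false j j∉Z = proj₁ (circuit B Z-basis j j∉Z)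

    C : Fin n → Subset n
    C j = fundamental (lookup Z j) j refl

    C-dependency : ∀ j → Dependency B (C j)
    C-dependency j = go (lookup Z j) refl
      where
      go : ∀ b (e : lookup Z j ≡ b) → Dependency B (fundamental b j e)
      go true e i = additive-⊥ (additive-xorSum (B i))
      go false e = proj₁ (proj₂ (proj₂ (circuit B Z-basis j e)))

    C-off : ∀ j v → lookup Z v ≡ false → lookup (C j) v ≡ lookup ⁅ j ⁆ v
    C-off j v v∉Z = go (lookup Z j) refl
      where
      go : ∀ b (e : lookup Z j ≡ b) → lookup (fundamental b j e) v ≡ lookup ⁅ j ⁆ v
      go true e = trans (lookup-⊥ v)
        (sym (lookup-⁅⁆-≢ {i = v} {j} λ { refl → case trans (sym e) v∉Z of λ () }))
      go false e with circuit B Z-basis j e | v Fin.≟ j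
      ... | S , _ , _ , Sj | yes refl = trans Sj (sym (lookup-⁅⁆ v))
      ... | S , S⊑ , _ , _ | no v≢j =
        trans (S⊑ v (∪ᵇ-⁅⁆-out B Z j v v∉Z v≢j)) (sym (lookup-⁅⁆-≢ v≢j))

    C-on : ∀ j → lookup Z j ≡ true → C j ≡ ⊥
    C-on j j∈Z = go (lookup Z j) refl j∈Z
      where
      go : ∀ b (e : lookup Z j ≡ b) → b ≡ true → fundamental b j e ≡ ⊥
      go true e _ = refl

  u : Fin n → Form n
  u v p = xorSum p (λ j → lookup (C j) v)

  -- Off `Z` the value is forced: it is the only one that makes the vector orthogonal to the
  -- fundamental circuit `C v`, which consists of `v` and `Z ∩ C v`.
  x : Fin n → Form n
  x v p = if lookup Z v then lookup p v else xorSum p (lookup (Z ∩ C v))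

  u-additive : ∀ v → Additive (u v)
  u-additive v = additive-xorSum (λ j → lookup (C j) v)

  x-additive : ∀ v → Additive (x v)
  x-additive v with lookup Z v
  ... | true = additive-lookup v
  ... | false = additive-xorSum (lookup (Z ∩ C v))

  x-on : ∀ v p → lookup Z v ≡ true → x v p ≡ lookup p v
  x-on v p v∈Z rewrite v∈Z = refl

  x-off : ∀ v p → lookup Z v ≡ false → x v p ≡ xorSum p (lookup (Z ∩ C v))
  x-off v p v∉Z rewrite v∉Z = refl

  u-off : ∀ v p → lookup Z v ≡ false → u v p ≡ lookup p v
  u-off v p v∉Z = trans (xorSum-cong p (λ j → C-off j v v∉Z)) (sym (additive-expand (additive-lookup v) p))

  cycle : Subset n → Subset n
  cycle p = tabulate (λ v → u v p)

  lookup-cycle : ∀ p v → lookup (cycle p) v ≡ u v p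
  lookup-cycle p v = Vec.lookup∘tabulate (λ v → u v p) v

  cycle-△ : ∀ p q → cycle (p △ q) ≡ cycle p △ cycle q
  cycle-△ p q = lookup-ext λ v → begin
    lookup (cycle (p △ q)) v                        ≡⟨ lookup-cycle (p △ q) v ⟩
    u v (p △ q)                                     ≡⟨ homo (u-additive v) p q ⟩
    u v p xor u v q                                 ≡⟨ cong₂ _xor_ (lookup-cycle p v) (lookup-cycle q v) ⟨
    lookup (cycle p) v xor lookup (cycle q) v       ≡⟨ lookup-△ (cycle p) (cycle q) v ⟨
    lookup (cycle p △ cycle q) v                    ∎
    where open ≡-Reasoning

  cycle-⁅⁆ : ∀ j → cycle ⁅ j ⁆ ≡ C j
  cycle-⁅⁆ j = lookup-ext λ v → trans (lookup-cycle ⁅ j ⁆ v) (xorSum-⁅⁆ j _)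

  xorSum-cycle-additive : ∀ f → Additive (λ p → xorSum (cycle p) f)
  xorSum-cycle-additive f = additive λ p q →
    trans (cong (λ S → xorSum S f) (cycle-△ p q)) (xorSum-△ f (cycle p) (cycle q))

  cycle-dependency : ∀ p → Dependency B (cycle p)
  cycle-dependency p i = additive-vanish (xorSum-cycle-additive (B i))
    (λ j → trans (cong (λ S → xorSum S (B i)) (cycle-⁅⁆ j)) (C-dependency j i)) p

  -- A cycle is determined by its part off `Z`: the difference of `S` and `cycle S` is a dependency
  -- that vanishes off `Z`, and `Z` is independent.
  dependency⇒cycle : ∀ S → Dependency B S → S ≡ cycle S
  dependency⇒cycle S dep = △≡⊥⇒≡ S (cycle S) (colIndep-elim B (basis⇒indep B Z-basis) _
    (λ i i∉Z → trans (lookup-△ S (cycle S) i)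
       (trans (cong (lookup S i xor_) (trans (lookup-cycle S i) (u-off i S i∉Z))) (Bool.xor-same (lookup S i))))
    (Dependency-△ B {S} {cycle S} dep (cycle-dependency S)))

  C-split : ∀ j → lookup Z j ≡ false → C j ≡ ⁅ j ⁆ △ (Z ∩ C j)
  C-split j j∉Z = lookup-ext λ v → begin
    lookup (C j) v                                   ≡⟨ pointwise v ⟩
    lookup ⁅ j ⁆ v xor (lookup Z v ∧ lookup (C j) v) ≡⟨ cong (lookup ⁅ j ⁆ v xor_) (Vec.lookup-zipWith _∧_ v Z (C j)) ⟨
    lookup ⁅ j ⁆ v xor lookup (Z ∩ C j) v            ≡⟨ lookup-△ ⁅ j ⁆ (Z ∩ C j) v ⟨
    lookup (⁅ j ⁆ △ (Z ∩ C j)) v                     ∎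
    where
    open ≡-Reasoning
    pointwise : ∀ v → lookup (C j) v ≡ lookup ⁅ j ⁆ v xor (lookup Z v ∧ lookup (C j) v)
    pointwise v with lookup Z v in Zv
    ... | false = trans (C-off j v Zv) (sym (Bool.xor-identityʳ _))
    ... | true = cong (_xor lookup (C j) v)
      (sym (lookup-⁅⁆-≢ {i = v} {j} λ { refl → case trans (sym Zv) j∉Z of λ () }))

  ∩-on : ∀ (D : Subset n) v → lookup (Z ∩ D) v ≡ true → lookup Z v ≡ true
  ∩-on D v e with lookup Z v | trans (sym (Vec.lookup-zipWith _∧_ v Z D)) e
  ... | true | _ = refl

  C⊥x : ∀ p j → xorSum (C j) (λ v → x v p) ≡ false
  C⊥x p j with lookup Z j in Zj
  ... | true = trans (cong (λ S → xorSum S (λ v → x v p)) (C-on j Zj)) (additive-⊥ (additive-xorSum (λ v → x v p)))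
  ... | false = begin
    xorSum (C j) x′                                  ≡⟨ cong (λ S → xorSum S x′) (C-split j Zj) ⟩
    xorSum (⁅ j ⁆ △ (Z ∩ C j)) x′                    ≡⟨ xorSum-△ x′ ⁅ j ⁆ (Z ∩ C j) ⟩
    xorSum ⁅ j ⁆ x′ xor xorSum (Z ∩ C j) x′          ≡⟨ cong₂ _xor_ left right ⟩
    xorSum p (lookup (Z ∩ C j)) xor xorSum p (lookup (Z ∩ C j)) ≡⟨ Bool.xor-same (xorSum p (lookup (Z ∩ C j))) ⟩
    false ∎
    where
    open ≡-Reasoning
    x′ = λ v → x v p
    left : xorSum ⁅ j ⁆ x′ ≡ xorSum p (lookup (Z ∩ C j))
    left = trans (xorSum-⁅⁆ j x′) (x-off j p Zj)
    right : xorSum (Z ∩ C j) x′ ≡ xorSum p (lookup (Z ∩ C j))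
    right = trans (xorSum-cong-on (Z ∩ C j) λ v e → x-on v p (∩-on (C j) v e)) (xorSum-comm (Z ∩ C j) p)

  cycle⊥x : ∀ p q → xorSum (cycle q) (λ v → x v p) ≡ false
  cycle⊥x p = additive-vanish (xorSum-cycle-additive (λ v → x v p))
    (λ j → trans (cong (λ S → xorSum S (λ v → x v p)) (cycle-⁅⁆ j)) (C⊥x p j))

  -- Bases as nonsingular square systems

  open Rows x u x-additive u-additive public

  lookup-select : ∀ a b (Y : Subset n) v → lookup (select a b Y) v ≡ (if lookup Y v then a else b)
  lookup-select a b Y v = Vec.lookup-map v (λ y → if y then a else b) Y

  row-select : ∀ a b Y v p → row (lookup (select a b Y) v) v p ≡ (if lookup Y v then row a v p else row b v p)
  row-select a b Y v p rewrite lookup-select a b Y v with lookup Y v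
  ... | true = refl
  ... | false = refl

  ≡⊥-by-coordinates : ∀ p → (∀ v → lookup Z v ≡ true → x v p ≡ false) →
    (∀ v → lookup Z v ≡ false → u v p ≡ false) → p ≡ ⊥
  ≡⊥-by-coordinates p on off = lookup-ext λ v → trans (at v) (sym (lookup-⊥ v))
    where
    at : ∀ v → lookup p v ≡ false
    at v with lookup Z v in Zv
    ... | true = trans (sym (x-on v p Zv)) (on v Zv)
    ... | false = trans (sym (u-off v p Zv)) (off v Zv)

  -- Independence of `Y` kills the cycle, whose support lies in `Y`. Maximality kills the cocycle:
  -- it vanishes on `Y`, and every other element lies in a circuit whose remaining elements are in
  -- `Y`.
  basis⇒nonsingular : ∀ Y → colBasis B Y ≡ true → nonsingular (select α β Y) ≡ true
  basis⇒nonsingular Y basis = nonsingular-intro (select α β Y) λ p zeros →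
    let
      at = λ v → trans (sym (row-select α β Y v p)) (zeros v)
      x-zero : ∀ v → lookup Y v ≡ true → x v p ≡ false
      x-zero v v∈Y = trans (sym (cong (if_then x v p else u v p) v∈Y)) (at v)
      u-zero : ∀ v → lookup Y v ≡ false → u v p ≡ false
      u-zero v v∉Y = trans (sym (cong (if_then x v p else u v p) v∉Y)) (at v)
      cycle≡⊥ : cycle p ≡ ⊥
      cycle≡⊥ = colIndep-elim B (basis⇒indep B basis) (cycle p)
        (λ v v∉Y → trans (lookup-cycle p v) (u-zero v v∉Y)) (cycle-dependency p)
    in ≡⊥-by-coordinates p (λ v _ → x-all p x-zero v (lookup Y v) refl)
         (λ v _ → trans (sym (lookup-cycle p v)) (trans (cong (λ S → lookup S v) cycle≡⊥) (lookup-⊥ v)))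
    where
    x-all : ∀ p → (∀ v → lookup Y v ≡ true → x v p ≡ false) →
      ∀ v b → lookup Y v ≡ b → x v p ≡ false
    x-all p x-zero v true v∈Y = x-zero v v∈Y
    -- `S` is orthogonal to the cocycle, and `⁅ v ⁆ △ S` lies in `Y`, where the cocycle vanishes; so
    -- its value at `v` vanishes too.
    x-all p x-zero v false v∉Y with circuit B basis v v∉Y
    ... | S , S⊑ , dep , Sv = begin
      x v p                           ≡⟨ xorSum-⁅⁆ v x′ ⟨
      xorSum ⁅ v ⁆ x′                 ≡⟨ Bool.xor-identityʳ _ ⟨
      xorSum ⁅ v ⁆ x′ xor false       ≡⟨ cong (xorSum ⁅ v ⁆ x′ xor_) S⊥x ⟨
      xorSum ⁅ v ⁆ x′ xor xorSum S x′ ≡⟨ xorSum-△ x′ ⁅ v ⁆ S ⟨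
      xorSum (⁅ v ⁆ △ S) x′           ≡⟨ xorSum-cong-on (⁅ v ⁆ △ S) vanish ⟩
      xorSum (⁅ v ⁆ △ S) (λ _ → false) ≡⟨ xorSum-false (⁅ v ⁆ △ S) ⟩
      false ∎
      where
      open ≡-Reasoning
      x′ = λ w → x w p
      S⊥x : xorSum S x′ ≡ false
      S⊥x = trans (cong (λ T → xorSum T x′) (dependency⇒cycle S dep)) (cycle⊥x p S)
      vanish : ∀ w → lookup (⁅ v ⁆ △ S) w ≡ true → x w p ≡ false
      vanish w e with lookup Y w in Yw
      ... | true = x-zero w Yw
      ... | false with w Fin.≟ v
      ... | yes refl = case trans (sym e) (trans (lookup-△ ⁅ v ⁆ S v) (cong₂ _xor_ (lookup-⁅⁆ v) Sv)) of λ ()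
      ... | no w≢v = case trans (sym e) (trans (lookup-△ ⁅ v ⁆ S w)
              (cong₂ _xor_ (lookup-⁅⁆-≢ w≢v) (S⊑ w (∪ᵇ-⁅⁆-out B Y v w Yw w≢v)))) of λ ()

  nonsingular⇒basis : ∀ Y → nonsingular (select α β Y) ≡ true → colBasis B Y ≡ true
  nonsingular⇒basis Y ns = cong₂ _∧_ indep
    (allOut-tabulate Y λ j j∉Y → cong not (Bool.¬-not (maximal j j∉Y)))
    where
    -- For a cycle `S` this is the parameter of the pair (0 , S): the cocycle reads only the
    -- coordinates on `Z`, the cycle only those off `Z`.
    offZ : Subset n → Subset n
    offZ S = ∁ Z ∩ S

    lookup-offZ : ∀ S v → lookup (offZ S) v ≡ not (lookup Z v) ∧ lookup S v
    lookup-offZ S v = trans (Vec.lookup-zipWith _∧_ v (∁ Z) S) (cong (_∧ lookup S v) (Vec.lookup-map v not Z))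

    u-offZ : ∀ S v → u v (offZ S) ≡ u v S
    u-offZ S v = begin
      xorSum (offZ S) c ≡⟨ xorSum-full (offZ S) c ⟩
      xorSum (full n) (λ j → lookup (offZ S) j ∧ c j) ≡⟨ xorSum-cong (full n) pointwise ⟩
      xorSum (full n) (λ j → lookup S j ∧ c j) ≡⟨ xorSum-full S c ⟨
      xorSum S c ∎
      where
      open ≡-Reasoning
      c = λ j → lookup (C j) v
      pointwise : ∀ j → lookup (offZ S) j ∧ c j ≡ lookup S j ∧ c j
      pointwise j rewrite lookup-offZ S j with lookup Z j in Zj
      ... | false = refl
      ... | true = sym (trans (cong (lookup S j ∧_) (trans (cong (λ T → lookup T v) (C-on j Zj)) (lookup-⊥ v)))
                              (Bool.∧-zeroʳ (lookup S j)))

    x-offZ : ∀ S v → x v (offZ S) ≡ false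
    x-offZ S v with lookup Z v in Zv
    ... | true = trans (lookup-offZ S v) (cong (λ b → not b ∧ lookup S v) Zv)
    ... | false = trans (xorSum-cong-on (offZ S) vanish) (xorSum-false (offZ S))
      where
      vanish : ∀ w → lookup (offZ S) w ≡ true → lookup (Z ∩ C v) w ≡ false
      vanish w e rewrite lookup-offZ S w | Vec.lookup-zipWith _∧_ w Z (C v) with lookup Z w
      ... | false = refl

    indep : colIndep B Y ≡ true
    indep = colIndep-intro B λ S S⊑Y dep →
      let
        u≡S : ∀ v → u v (offZ S) ≡ lookup S v
        u≡S v = trans (u-offZ S v) (trans (sym (lookup-cycle S v)) (cong (λ T → lookup T v) (sym (dependency⇒cycle S dep))))
        zeros : ∀ v → row (lookup (select α β Y) v) v (offZ S) ≡ false
        zeros v = trans (row-select α β Y v (offZ S))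
          (if-false (lookup Y v) (λ _ → x-offZ S v) (λ v∉Y → trans (u≡S v) (S⊑Y v v∉Y)))
        offZ≡⊥ = nonsingular-elim (select α β Y) ns (offZ S) zeros
      in lookup-ext λ v → trans (sym (u≡S v))
           (trans (cong (u v) offZ≡⊥) (trans (additive-⊥ (u-additive v)) (sym (lookup-⊥ v))))

    -- Dropping row `j` leaves a nonzero zero `p` of the other rows. Its cycle lies in `Y` with `j`
    -- added; were that set independent, the cycle would vanish, row `j` would hold as well, and `p`
    -- would be a zero of the whole system.
    maximal : ∀ j → lookup Y j ≡ false → colIndep B (Y ∪ᵇ ⁅ j ⁆) ≢ true
    maximal j j∉Y indep′ with zero-off j (select α β Y)
    ... | p , p≢⊥ , off = p≢⊥ (nonsingular-elim (select α β Y) ns p zeros)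
      where
      u-zero : ∀ v → lookup (Y ∪ᵇ ⁅ j ⁆) v ≡ false → u v p ≡ false
      u-zero v v∉ with lookup Y v in Yv | v Fin.≟ j
      ... | false | no v≢j = trans
        (sym (trans (row-select α β Y v p) (cong (if_then x v p else u v p) Yv))) (off v v≢j)
      ... | false | yes refl = case trans (sym v∉) (trans (Vec.lookup-zipWith _∨_ v Y ⁅ v ⁆)
              (cong₂ _∨_ Yv (lookup-⁅⁆ v))) of λ ()
      ... | true | _ = case trans (sym v∉) (trans (Vec.lookup-zipWith _∨_ v Y ⁅ j ⁆)
              (cong (_∨ lookup ⁅ j ⁆ v) Yv)) of λ ()
      cycle≡⊥ : cycle p ≡ ⊥
      cycle≡⊥ = colIndep-elim B indep′ (cycle p) (λ v v∉ → trans (lookup-cycle p v) (u-zero v v∉)) (cycle-dependency p)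
      zeros : ∀ v → row (lookup (select α β Y) v) v p ≡ false
      zeros v with v Fin.≟ j
      ... | no v≢j = off v v≢j
      ... | yes refl = trans (row-select α β Y v p) (trans (cong (if_then x v p else u v p) j∉Y)
              (trans (sym (lookup-cycle p v)) (trans (cong (λ T → lookup T v) cycle≡⊥) (lookup-⊥ v))))

  colBasis≡nonsingular : ∀ Y → colBasis B Y ≡ nonsingular (select α β Y)
  colBasis≡nonsingular Y = ≡true-ext (basis⇒nonsingular Y) (nonsingular⇒basis Y)

  -- A count of conditions. The equations p = 0 off `Z`, which force the cycle to vanish, and x = 0
  -- on `Y` number n - |Z| + |Y|. If `Y` were smaller than `Z`, they would have a nonzero solution,
  -- contrary to nonsingularity of the system of `Y`. The concatenation `∁ Z Vec.++ Y` selects these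
  -- equations among 2n forms.
  basis-size-≤ : ∀ Y → colBasis B Y ≡ true → ∣ Z ∣ ≤ ∣ Y ∣
  basis-size-≤ Y basis = ℕ.≮⇒≥ λ Y<Z →
    let
      size : ∣ ∁ Z Vec.++ Y ∣ < n
      size = subst (_< n) (sym (∣++∣ (∁ Z) Y)) (subst (λ m → m ℕ.+ ∣ Y ∣ < n) (sym (Sub.∣∁p∣≡n∸∣p∣ Z))
        (subst (n ℕ.∸ ∣ Z ∣ ℕ.+ ∣ Y ∣ <_) (ℕ.m∸n+n≡m (Sub.∣p∣≤n Z)) (ℕ.+-monoʳ-< (n ℕ.∸ ∣ Z ∣) Y<Z)))
      p , p≢⊥ , zeros = common-zero n (λ i → form (Fin.splitAt n i)) (λ i → form-additive (Fin.splitAt n i)) (∁ Z Vec.++ Y) size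
      u-zero : ∀ v → u v p ≡ false
      u-zero v = trans (xorSum-cong-on p (C-zero p zeros v)) (xorSum-false p)
      x-zero : ∀ v → lookup Y v ≡ true → x v p ≡ false
      x-zero v v∈Y = trans (cong (λ s → form s p) (sym (Fin.splitAt-↑ʳ n n v)))
        (zeros (n Fin.↑ʳ v) (Vec.lookup⇒[]= _ _ (trans (Vec.lookup-++ʳ (∁ Z) Y v) v∈Y)))
    in p≢⊥ (nonsingular-elim (select α β Y) (basis⇒nonsingular Y basis) p λ v →
         trans (row-select α β Y v p) (if-false (lookup Y v) (x-zero v) (λ _ → u-zero v)))
    where
    form : Fin n ⊎ Fin n → Form n
    form (inj₁ v) p = lookup p v
    form (inj₂ v) p = x v p

    form-additive : ∀ s → Additive (form s)
    form-additive (inj₁ v) = additive-lookup v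
    form-additive (inj₂ v) = x-additive v

    C-zero : ∀ p → (∀ i → i ∈ (∁ Z Vec.++ Y) → form (Fin.splitAt n i) p ≡ false) →
      ∀ v j → lookup p j ≡ true → lookup (C j) v ≡ false
    C-zero p zeros v j pj with lookup Z j in Zj
    ... | true = trans (cong (λ T → lookup T v) (C-on j Zj)) (lookup-⊥ v)
    ... | false = case trans (sym pj) (trans (cong (λ s → form s p) (sym (Fin.splitAt-↑ˡ n j n)))
            (zeros (j Fin.↑ˡ n) (Vec.lookup⇒[]= _ _ (trans (Vec.lookup-++ˡ (∁ Z) Y j)
              (trans (Vec.lookup-map j not Z) (cong not Zj)))))) of λ ()

  -- The symmetric matrix of the twisted dual pivot

  shear : Subset n → Subset n
  shear p = tabulate λ v → if lookup Z v then lookup p v else lookup p v xor x v p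

  lookup-shear : ∀ p v → lookup (shear p) v ≡ (if lookup Z v then lookup p v else lookup p v xor x v p)
  lookup-shear p v = Vec.lookup∘tabulate _ v

  shear-on : ∀ p v → lookup Z v ≡ true → lookup (shear p) v ≡ lookup p v
  shear-on p v v∈Z = trans (lookup-shear p v) (cong (if_then lookup p v else lookup p v xor x v p) v∈Z)

  shear-off : ∀ p v → lookup Z v ≡ false → lookup (shear p) v ≡ lookup p v xor x v p
  shear-off p v v∉Z = trans (lookup-shear p v) (cong (if_then lookup p v else lookup p v xor x v p) v∉Z)

  x-shear : ∀ p v → x v (shear p) ≡ x v p
  x-shear p v with lookup Z v in Zv
  ... | true = shear-on p v Zv
  ... | false = begin
    xorSum (shear p) (lookup (Z ∩ C v)) ≡⟨ xorSum-comm (shear p) (Z ∩ C v) ⟩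
    xorSum (Z ∩ C v) (lookup (shear p)) ≡⟨ xorSum-cong-on (Z ∩ C v) (λ w e → shear-on p w (∩-on (C v) w e)) ⟩
    xorSum (Z ∩ C v) (lookup p)         ≡⟨ xorSum-comm (Z ∩ C v) p ⟩
    xorSum p (lookup (Z ∩ C v))         ∎
    where open ≡-Reasoning

  -- What `shear` adds off `Z` depends only on the coordinates on `Z`, which it fixes; applied
  -- twice, it adds the same bit twice.
  shear-involutive : ∀ p → shear (shear p) ≡ p
  shear-involutive p = lookup-ext at
    where
    at : ∀ v → lookup (shear (shear p)) v ≡ lookup p v
    at v with lookup Z v in Zv
    ... | true = trans (shear-on (shear p) v Zv) (shear-on p v Zv)
    ... | false = begin
      lookup (shear (shear p)) v                ≡⟨ shear-off (shear p) v Zv ⟩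
      lookup (shear p) v xor x v (shear p)      ≡⟨ cong₂ _xor_ (shear-off p v Zv) (x-shear p v) ⟩
      (lookup p v xor x v p) xor x v p          ≡⟨ Bool.xor-assoc (lookup p v) _ _ ⟩
      lookup p v xor (x v p xor x v p)          ≡⟨ cong (lookup p v xor_) (Bool.xor-same (x v p)) ⟩
      lookup p v xor false                      ≡⟨ Bool.xor-identityʳ _ ⟩
      lookup p v                                ∎
      where open ≡-Reasoning

  lookup-shear-additive : ∀ v → Additive (λ p → lookup (shear p) v)
  lookup-shear-additive v = additive λ p q →
    trans (lookup-shear (p △ q) v) (trans (go p q) (sym (cong₂ _xor_ (lookup-shear p v) (lookup-shear q v))))
    where
    go : ∀ p q → (if lookup Z v then lookup (p △ q) v else lookup (p △ q) v xor x v (p △ q)) ≡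
      (if lookup Z v then lookup p v else lookup p v xor x v p) xor
      (if lookup Z v then lookup q v else lookup q v xor x v q)
    go p q with lookup Z v | homo (x-additive v) p q
    ... | true | _ = lookup-△ p q v
    ... | false | e = trans (cong₂ _xor_ (lookup-△ p q v) e) (xor-interchange (lookup p v) (lookup q v) _ _)

  shear-△ : ∀ p q → shear (p △ q) ≡ shear p △ shear q
  shear-△ p q = lookup-ext λ v →
    trans (homo (lookup-shear-additive v) p q) (sym (lookup-△ (shear p) (shear q) v))

  shear-⊥ : shear ⊥ ≡ ⊥
  shear-⊥ = lookup-ext λ v → trans (additive-⊥ (lookup-shear-additive v)) (sym (lookup-⊥ v))

  -- The sheared coordinates are the values of the rows labelled `select α γ Z`, the system that
  -- belongs to the empty set after the twist by `Z`.
  lookup-shear-row : ∀ p v → lookup (shear p) v ≡ (if lookup Z v then x v p else x v p xor u v p)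
  lookup-shear-row p v with lookup Z v in Zv
  ... | true = shear-on p v Zv
  ... | false = trans (shear-off p v Zv) (trans (cong₂ _xor_ (sym (u-off v p Zv)) (x-off v p Zv)) (Bool.xor-comm (u v p) _))

  -- Of the labels α and γ, the one that `shear` does not use at `v`.
  graph-row : Fin n → Form n
  graph-row v p = if lookup Z v then x v p xor u v p else x v p

  graph-row-additive : ∀ v → Additive (graph-row v)
  graph-row-additive v = go (lookup Z v)
    where
    go : ∀ b → Additive (λ p → if b then x v p xor u v p else x v p)
    go true = row-additive γ v
    go false = x-additive v

  -- In block form along Z and its complement, with A the fundamental matrix of Z:
  -- G = [ I + A Aᵀ , A ; Aᵀ , 0 ].
  G : Graph n
  G i j = graph-row i (shear ⁅ j ⁆)

  xorSum-G : ∀ S i → xorSum S (G i) ≡ graph-row i (shear S)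
  xorSum-G S i = sym (additive-expand
    (additive λ p q → trans (cong (graph-row i) (shear-△ p q)) (homo (graph-row-additive i) (shear p) (shear q))) S)

  symplectic : Subset n → Subset n → Bool
  symplectic p q = xorSum (full n) λ v → lookup (shear p) v ∧ graph-row v q

  -- At each `v` the pair (shear , graph-row) is (x , x + u) or (x + u , x), a change of basis of
  -- determinant 1 from (x , u). It preserves the standard alternating form, and that form vanishes
  -- here by `cycle⊥x`.
  symplectic-comm : ∀ p q → symplectic p q ≡ symplectic q p
  symplectic-comm p q = xor≡false⇒≡ _ _ (begin
    symplectic p q xor symplectic q p ≡⟨ xorSum-xor (full n) _ _ ⟨
    xorSum (full n) (λ v → (lookup (shear p) v ∧ graph-row v q) xor (lookup (shear q) v ∧ graph-row v p))
      ≡⟨ xorSum-cong (full n) pointwise ⟩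
    xorSum (full n) (λ v → (lookup (cycle p) v ∧ x v q) xor (lookup (cycle q) v ∧ x v p))
      ≡⟨ xorSum-xor (full n) _ _ ⟩
    xorSum (full n) (λ v → lookup (cycle p) v ∧ x v q) xor xorSum (full n) (λ v → lookup (cycle q) v ∧ x v p)
      ≡⟨ cong₂ _xor_ (xorSum-full (cycle p) _) (xorSum-full (cycle q) _) ⟨
    xorSum (cycle p) (λ v → x v q) xor xorSum (cycle q) (λ v → x v p)
      ≡⟨ cong₂ _xor_ (cycle⊥x q p) (cycle⊥x p q) ⟩
    false ∎)
    where
    open ≡-Reasoning
    open xor-∧-Solver using (solve; _:*_; _:+_; _:=_)
    identity : ∀ z a b c d →
      ((if z then a else a xor b) ∧ (if z then c xor d else c)) xor
      ((if z then c else c xor d) ∧ (if z then a xor b else a)) ≡ (b ∧ c) xor (d ∧ a)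
    identity true = solve 4 (λ a b c d → (a :* (c :+ d)) :+ (c :* (a :+ b)) := (b :* c) :+ (d :* a)) refl
    identity false = solve 4 (λ a b c d → ((a :+ b) :* c) :+ ((c :+ d) :* a) := (b :* c) :+ (d :* a)) refl
    pointwise : ∀ v → (lookup (shear p) v ∧ graph-row v q) xor (lookup (shear q) v ∧ graph-row v p) ≡
      (lookup (cycle p) v ∧ x v q) xor (lookup (cycle q) v ∧ x v p)
    pointwise v
      rewrite lookup-shear-row p v | lookup-shear-row q v | lookup-cycle p v | lookup-cycle q v
      = identity (lookup Z v) (x v p) (u v p) (x v q) (u v q)

  G-symmetric : ∀ i j → G i j ≡ G j i
  G-symmetric i j = trans (entry i j) (trans (symplectic-comm (shear ⁅ i ⁆) (shear ⁅ j ⁆)) (sym (entry j i)))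
    where
    -- Writing `⁅ i ⁆` as `shear (shear ⁅ i ⁆)` turns a matrix entry into a value of the form.
    entry : ∀ i j → G i j ≡ symplectic (shear ⁅ i ⁆) (shear ⁅ j ⁆)
    entry i j = begin
      graph-row i (shear ⁅ j ⁆)                          ≡⟨ xorSum-⁅⁆ i _ ⟨
      xorSum ⁅ i ⁆ (λ v → graph-row v (shear ⁅ j ⁆))     ≡⟨ xorSum-full ⁅ i ⁆ _ ⟩
      xorSum (full n) (λ v → lookup ⁅ i ⁆ v ∧ graph-row v (shear ⁅ j ⁆))
        ≡⟨ cong (λ S → xorSum (full n) (λ v → lookup S v ∧ graph-row v (shear ⁅ j ⁆))) (shear-involutive ⁅ i ⁆) ⟨
      symplectic (shear ⁅ i ⁆) (shear ⁅ j ⁆)             ∎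
      where open ≡-Reasoning

  row-graph : ∀ Y v p → row (lookup (select α γ (Y △ Z)) v) v p ≡
    (if lookup Y v then graph-row v p else lookup (shear p) v)
  row-graph Y v p rewrite row-select α γ (Y △ Z) v p | lookup-△ Y Z v | lookup-shear-row p v
    with lookup Y v | lookup Z v
  ... | false | false = refl
  ... | false | true = refl
  ... | true | false = refl
  ... | true | true = refl

  -- Substitute S = shear p. By `row-graph`, the rows at elements off `Y` say that `S` is supported
  -- on `Y`, and those at elements of `Y` say that G S vanishes there.
  MG≡nonsingular : ∀ Y → MG G Y ≡ nonsingular (select α γ (Y △ Z))
  MG≡nonsingular Y = ≡true-ext ⇒ ⇐
    where
    t = select α γ (Y △ Z)

    ⇒ : MG G Y ≡ true → nonsingular t ≡ true
    ⇒ h = nonsingular-intro t λ p zeros →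
      let
        at : ∀ v → (if lookup Y v then graph-row v p else lookup (shear p) v) ≡ false
        at v = trans (sym (row-graph Y v p)) (zeros v)
        shear≡⊥ = trivialOn-elim {X = Y} h (shear p)
          (λ v v∉Y → trans (sym (cong (if_then graph-row v p else lookup (shear p) v) v∉Y)) (at v))
          (anyIn-all-false Y λ v v∈Y → trans (xorSum-G (shear p) v)
            (trans (cong (graph-row v) (shear-involutive p))
              (trans (sym (cong (if_then graph-row v p else lookup (shear p) v) v∈Y)) (at v))))
      in trans (sym (shear-involutive p)) (trans (cong shear shear≡⊥) shear-⊥)

    ⇐ : nonsingular t ≡ true → MG G Y ≡ true
    ⇐ ns = trivialOn-intro λ S S⊑Y e →
      let
        zeros : ∀ v → row (lookup t v) v (shear S) ≡ false
        zeros v = trans (row-graph Y v (shear S)) (if-false (lookup Y v)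
          (λ v∈Y → trans (sym (xorSum-G S v)) (anyIn-none Y e v v∈Y))
          (λ v∉Y → trans (cong (λ T → lookup T v) (shear-involutive S)) (S⊑Y v v∉Y)))
      in trans (sym (shear-involutive S)) (trans (cong shear (nonsingular-elim t ns (shear S) zeros)) shear-⊥)

-- Set systems

restrict : Bool → SetSystem (suc n) → SetSystem n
restrict b D Y = D (b ∷ Y)

_⊕_ : SetSystem n → SetSystem n → SetSystem n
(D ⊕ E) Y = D Y xor E Y

-- The dual pivot by recursion on coordinates: a set `W` counted for `Y` is free to contain an
-- element exactly when the element is in `X` and not in `Y`.
pivot : SetSystem n → Subset n → SetSystem n
pivot D [] [] = D []
pivot D (false ∷ X) (b ∷ Y) = pivot (restrict b D) X Y
pivot D (true ∷ X) (true ∷ Y) = pivot (restrict true D) X Y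
pivot D (true ∷ X) (false ∷ Y) = pivot (restrict false D) X Y xor pivot (restrict true D) X Y

parity : ∀ {A : Set} → (A → Bool) → List A → Bool
parity g = List.foldr (λ W r → g W xor r) false

odd-length-filter : ∀ {A : Set} (g : A → Bool) xs →
  odd (List.length (List.filter (λ W → g W Bool.≟ true) xs)) ≡ parity g xs
odd-length-filter g [] = refl
odd-length-filter g (W ∷ xs) with g W
... | true = cong not (odd-length-filter g xs)
... | false = odd-length-filter g xs

parity-++ : ∀ {A : Set} (g : A → Bool) xs ys → parity g (xs List.++ ys) ≡ parity g xs xor parity g ys
parity-++ g [] ys = refl
parity-++ g (W ∷ xs) ys = trans (cong (g W xor_) (parity-++ g xs ys)) (sym (Bool.xor-assoc (g W) _ _))

parity-map : ∀ {A A′ : Set} (g : A′ → Bool) (f : A → A′) xs → parity g (List.map f xs) ≡ parity (λ W → g (f W)) xs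
parity-map g f [] = refl
parity-map g f (W ∷ xs) = cong (g (f W) xor_) (parity-map g f xs)

parity-false : ∀ {A : Set} {g : A → Bool} xs → (∀ W → g W ≡ false) → parity g xs ≡ false
parity-false [] h = refl
parity-false (W ∷ xs) h = cong₂ _xor_ (h W) (parity-false xs h)

interval : SetSystem n → Subset n → Subset n → SetSystem n
interval D X Y W = (Y ⊆ᵇ W) ∧ (W ⊆ᵇ (Y ∪ᵇ X)) ∧ D W

parity-interval : ∀ (D : SetSystem n) X Y → parity (interval D X Y) (allSubsets n) ≡ pivot D X Y
parity-interval D [] [] = Bool.xor-identityʳ (D [])
parity-interval {suc n} D (a ∷ X) (b ∷ Y) =
  trans (parity-++ g (List.map (false ∷_) (allSubsets n)) _)
    (trans (cong₂ _xor_ (parity-map g (false ∷_) (allSubsets n)) (parity-map g (true ∷_) (allSubsets n)))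
      (halves a b))
  where
  g = interval D (a ∷ X) (b ∷ Y)
  halves : ∀ a b → parity (λ W → interval D (a ∷ X) (b ∷ Y) (false ∷ W)) (allSubsets n) xor
                   parity (λ W → interval D (a ∷ X) (b ∷ Y) (true ∷ W)) (allSubsets n)
                   ≡ pivot D (a ∷ X) (b ∷ Y)
  halves false false = trans
    (cong₂ _xor_ (parity-interval (restrict false D) X Y)
                 (parity-false (allSubsets n) λ W → Bool.∧-zeroʳ (Y ⊆ᵇ W)))
    (Bool.xor-identityʳ _)
  halves true false = cong₂ _xor_ (parity-interval (restrict false D) X Y) (parity-interval (restrict true D) X Y)
  halves false true = cong₂ _xor_ (parity-false (allSubsets n) λ W → refl) (parity-interval (restrict true D) X Y)
  halves true true = cong₂ _xor_ (parity-false (allSubsets n) λ W → refl) (parity-interval (restrict true D) X Y)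

dualPivot≡pivot : ∀ (D : SetSystem n) X Y → dualPivot D X Y ≡ pivot D X Y
dualPivot≡pivot {n} D X Y =
  trans (odd-length-filter (interval D X Y) (allSubsets n)) (parity-interval D X Y)

pivot-⊕ : ∀ (D E : SetSystem n) X Y → pivot (D ⊕ E) X Y ≡ pivot D X Y xor pivot E X Y
pivot-⊕ D E [] [] = refl
pivot-⊕ D E (false ∷ X) (b ∷ Y) = pivot-⊕ (restrict b D) (restrict b E) X Y
pivot-⊕ D E (true ∷ X) (true ∷ Y) = pivot-⊕ (restrict true D) (restrict true E) X Y
pivot-⊕ D E (true ∷ X) (false ∷ Y) = trans
  (cong₂ _xor_ (pivot-⊕ (restrict false D) (restrict false E) X Y) (pivot-⊕ (restrict true D) (restrict true E) X Y))
  (xor-interchange (pivot (restrict false D) X Y) _ _ _)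

-- At an element off `Y` the pivot adds the term for sets containing it (label α) and the term for
-- sets avoiding it (label β), and additivity of `F` merges them into γ. A general `F` is needed
-- because the induction fixes the labels already treated.
pivot-select : ∀ (F : Vec Label n → Bool) →
  (∀ v t → F (t [ v ]≔ α) xor F (t [ v ]≔ β) ≡ F (t [ v ]≔ γ)) →
  (D : SetSystem n) → (∀ Y → D Y ≡ F (select α β Y)) → ∀ Y → pivot D (full n) Y ≡ F (select α γ Y)
pivot-select F F-xor D h [] = h []
pivot-select F F-xor D h (true ∷ Y) =
  pivot-select (λ t → F (α ∷ t)) (λ v t → F-xor (suc v) (α ∷ t)) (restrict true D) (λ Y → h (true ∷ Y)) Y
pivot-select F F-xor D h (false ∷ Y) = trans
  (cong₂ _xor_
    (pivot-select (λ t → F (β ∷ t)) (λ v t → F-xor (suc v) (β ∷ t)) (restrict false D) (λ Y → h (false ∷ Y)) Y)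
    (pivot-select (λ t → F (α ∷ t)) (λ v t → F-xor (suc v) (α ∷ t)) (restrict true D) (λ Y → h (true ∷ Y)) Y))
  (trans (Bool.xor-comm (F (β ∷ select α γ Y)) _) (F-xor zero (α ∷ select α γ Y)))

-- Minimum size of a feasible set

MinSpec : SetSystem n → List (Subset n) → Maybe ℕ → Set
MinSpec D xs nothing = ∀ Y → Y List.∈ xs → D Y ≡ false
MinSpec D xs (just m) = (∃ λ Y → D Y ≡ true × ∣ Y ∣ ≡ m) × (∀ Y → Y List.∈ xs → D Y ≡ true → m ≤ ∣ Y ∣)

minSpec : ∀ (D : SetSystem n) xs →
  MinSpec D xs (List.foldr (λ Y r → if D Y then minMaybe r ∣ Y ∣ else r) nothing xs)
minSpec D [] = λ Y ()
minSpec D (Y ∷ xs) with D Y in DY | List.foldr (λ Y r → if D Y then minMaybe r ∣ Y ∣ else r) nothing xs | minSpec D xs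
... | false | nothing | none = λ { _ (here refl) → DY ; W (there W∈) → none W W∈ }
... | false | just m | wit , least =
  wit , λ { _ (here refl) DW → case trans (sym DY) DW of λ () ; W (there W∈) → least W W∈ }
... | true | nothing | none =
  (Y , DY , refl) , λ { _ (here refl) _ → ℕ.≤-refl ; W (there W∈) DW → case trans (sym (none W W∈)) DW of λ () }
... | true | just m | (V , DV , V≡m) , least =
  witness (ℕ.⊓-sel m ∣ Y ∣) ,
  λ { _ (here refl) _ → ℕ.m⊓n≤n m _ ; W (there W∈) DW → ℕ.≤-trans (ℕ.m⊓n≤m m _) (least W W∈ DW) }
  where
  witness : m ℕ.⊓ ∣ Y ∣ ≡ m ⊎ m ℕ.⊓ ∣ Y ∣ ≡ ∣ Y ∣ → ∃ λ W → D W ≡ true × ∣ W ∣ ≡ m ℕ.⊓ ∣ Y ∣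
  witness (inj₁ e) = V , DV , trans V≡m (sym e)
  witness (inj₂ e) = Y , DY , sym e

-- The comparison of minimum sizes, stated set by set so that it can be proved one coordinate at a
-- time and also covers systems without feasible sets.
_≼_ : SetSystem n → SetSystem n → Set
D ≼ E = ∀ Y → E Y ≡ true → ∃ λ Y′ → D Y′ ≡ true × ∣ Y′ ∣ ≤ ∣ Y ∣

dmin-antisym : ∀ {D E : SetSystem n} → D ≼ E → E ≼ D → dmin D ≡ dmin E
dmin-antisym {n} {D} {E} D≼E E≼D
  with dmin D | minSpec D (allSubsets n) | dmin E | minSpec E (allSubsets n)
... | nothing | _ | nothing | _ = refl
... | nothing | none | just _ | (Y , EY , _) , _ with D≼E Y EY
...   | Y′ , DY′ , _ = case trans (sym (none Y′ (∈-allSubsets Y′))) DY′ of λ ()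
dmin-antisym {n} {D} {E} D≼E E≼D
    | just _ | (Y , DY , _) , _ | nothing | none with E≼D Y DY
...   | Y′ , EY′ , _ = case trans (sym (none Y′ (∈-allSubsets Y′))) EY′ of λ ()
dmin-antisym {n} {D} {E} D≼E E≼D
    | just _ | (Y , DY , refl) , leastD | just _ | (W , EW , refl) , leastE with E≼D Y DY | D≼E W EW
...   | Y′ , EY′ , Y′≤Y | W′ , DW′ , W′≤W = cong just (ℕ.≤-antisym
  (ℕ.≤-trans (leastD W′ (∈-allSubsets W′) DW′) W′≤W)
  (ℕ.≤-trans (leastE Y′ (∈-allSubsets Y′) EY′) Y′≤Y))

dmin-cong : ∀ {D E : SetSystem n} → (∀ Y → D Y ≡ E Y) → dmin D ≡ dmin E
dmin-cong h = dmin-antisym (λ Y EY → Y , trans (h Y) EY , ℕ.≤-refl) (λ Y DY → Y , trans (sym (h Y)) DY , ℕ.≤-refl)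

-- Exchanging the twist on the whole ground set with dual pivots

twist-pivot pivot-twist : SetSystem n → Subset n → SetSystem n
twist-pivot {n} D X = pivot (twist D (full n)) X
pivot-twist {n} D X = twist (pivot D (full n)) (X △ full n)

-- With its companion, this linearity lets the inductions that follow run on the sum of the two
-- restrictions of `D`.
twist-pivot-⊕ : ∀ (D E : SetSystem n) X Y →
  twist-pivot (D ⊕ E) X Y ≡ twist-pivot D X Y xor twist-pivot E X Y
twist-pivot-⊕ {n} D E X Y = pivot-⊕ (twist D (full n)) (twist E (full n)) X Y

pivot-twist-⊕ : ∀ (D E : SetSystem n) X Y →
  pivot-twist (D ⊕ E) X Y ≡ pivot-twist D X Y xor pivot-twist E X Y
pivot-twist-⊕ {n} D E X Y = pivot-⊕ D E (full n) (Y △ (X △ full n))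

-- At every coordinate the two systems have the same restriction to the sets avoiding it, and
-- their restrictions to the sets containing it differ by that common part (loop complementation).
-- A set lost in the passage is therefore replaced by a smaller one.
pivot-twist≼twist-pivot : ∀ (D : SetSystem n) X → pivot-twist D X ≼ twist-pivot D X
pivot-twist≼twist-pivot D [] [] h = [] , h , z≤n
pivot-twist≼twist-pivot D (false ∷ X) (false ∷ Y) h with pivot-twist≼twist-pivot (restrict true D) X Y h
... | Y′ , e , le = false ∷ Y′ , e , le
pivot-twist≼twist-pivot D (false ∷ X) (true ∷ Y) h with pivot-twist≼twist-pivot (restrict false D) X Y h
... | Y′ , e , le with pivot-twist (restrict true D) X Y′ in e₁
... | true = false ∷ Y′ , e₁ , ℕ.m≤n⇒m≤1+n le
... | false = true ∷ Y′ , cong₂ _xor_ e e₁ , s≤s le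
pivot-twist≼twist-pivot D (true ∷ X) (false ∷ Y) h
  with pivot-twist≼twist-pivot (restrict true D ⊕ restrict false D) X Y
         (trans (twist-pivot-⊕ (restrict true D) (restrict false D) X Y) h)
... | Y′ , e , le = false ∷ Y′ ,
  trans (Bool.xor-comm (pivot-twist (restrict false D) X Y′) _)
    (trans (sym (pivot-twist-⊕ (restrict true D) (restrict false D) X Y′)) e) , le
pivot-twist≼twist-pivot D (true ∷ X) (true ∷ Y) h with pivot-twist≼twist-pivot (restrict false D) X Y h
... | Y′ , e , le with pivot-twist (restrict true D) X Y′ in e₁
... | true = true ∷ Y′ , e₁ , s≤s le
... | false = false ∷ Y′ , cong₂ _xor_ e e₁ , ℕ.m≤n⇒m≤1+n le

twist-pivot≼pivot-twist : ∀ (D : SetSystem n) X → twist-pivot D X ≼ pivot-twist D X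
twist-pivot≼pivot-twist D [] [] h = [] , h , z≤n
twist-pivot≼pivot-twist D (false ∷ X) (false ∷ Y) h with twist-pivot≼pivot-twist (restrict true D) X Y h
... | Y′ , e , le = false ∷ Y′ , e , le
-- Here `h` concerns the sum of both restrictions. A set feasible for a sum is feasible for exactly
-- one summand: for `restrict false D` the new element is put in, for `restrict true D` it is left
-- out.
twist-pivot≼pivot-twist D (false ∷ X) (true ∷ Y) h
  with twist-pivot≼pivot-twist (restrict false D ⊕ restrict true D) X Y
         (trans (pivot-twist-⊕ (restrict false D) (restrict true D) X Y) h)
... | Y′ , e , le
  with twist-pivot (restrict false D) X Y′ in e₀ | twist-pivot-⊕ (restrict false D) (restrict true D) X Y′
... | true | _ = true ∷ Y′ , e₀ , s≤s le
... | false | sum = false ∷ Y′ , trans (sym sum) e , ℕ.m≤n⇒m≤1+n le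
twist-pivot≼pivot-twist D (true ∷ X) (false ∷ Y) h
  with twist-pivot≼pivot-twist (restrict false D ⊕ restrict true D) X Y
         (trans (pivot-twist-⊕ (restrict false D) (restrict true D) X Y) h)
... | Y′ , e , le = false ∷ Y′ ,
  trans (Bool.xor-comm (twist-pivot (restrict true D) X Y′) _)
    (trans (sym (twist-pivot-⊕ (restrict false D) (restrict true D) X Y′)) e) , le
twist-pivot≼pivot-twist D (true ∷ X) (true ∷ Y) h with twist-pivot≼pivot-twist (restrict true D) X Y h
... | Y′ , e , le with twist-pivot (restrict false D) X Y′ in e₀
... | true = true ∷ Y′ , e₀ , s≤s le
... | false = false ∷ Y′ , cong₂ _xor_ e e₀ , ℕ.m≤n⇒m≤1+n le

dmin-dualPivot-twist : ∀ (D : SetSystem n) X →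
  dmin (dualPivot (twist D (full n)) X) ≡ dmin (twist (dualPivot D (full n)) (X △ full n))
dmin-dualPivot-twist {n} D X = begin
  dmin (dualPivot (twist D (full n)) X)            ≡⟨ dmin-cong (dualPivot≡pivot (twist D (full n)) X) ⟩
  dmin (twist-pivot D X)                           ≡⟨ dmin-antisym (twist-pivot≼pivot-twist D X) (pivot-twist≼twist-pivot D X) ⟩
  dmin (pivot-twist D X)                           ≡⟨ dmin-cong (λ Y → dualPivot≡pivot D (full n) (Y △ (X △ full n))) ⟨
  dmin (twist (dualPivot D (full n)) (X △ full n)) ∎
  where open ≡-Reasoning

-- Rank as the maximum size of a basis

rank-≤ : ∀ {D : SetSystem n} {m} xs → (∀ Y → D Y ≡ true → ∣ Y ∣ ≤ m) →
  List.foldr (λ Y r → if D Y then ∣ Y ∣ ℕ.⊔ r else r) 0 xs ≤ m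
rank-≤ [] h = z≤n
rank-≤ {D = D} (Y ∷ xs) h with D Y in DY
... | true = ℕ.⊔-lub (h Y DY) (rank-≤ xs h)
... | false = rank-≤ xs h

rank-≥ : ∀ {D : SetSystem n} {Y} xs → Y List.∈ xs → D Y ≡ true →
  ∣ Y ∣ ≤ List.foldr (λ Y r → if D Y then ∣ Y ∣ ℕ.⊔ r else r) 0 xs
rank-≥ {D = D} (Y ∷ xs) (here refl) DY rewrite DY = ℕ.m≤m⊔n ∣ Y ∣ _
rank-≥ {D = D} (W ∷ xs) (there Y∈) DY with D W
... | true = ℕ.m≤n⇒m≤o⊔n ∣ W ∣ (rank-≥ xs Y∈ DY)
... | false = rank-≥ xs Y∈ DY

-- Alternating sums over subsets

sumL-cong : ∀ {A : Set} {f g : A → ℤ} xs → (∀ x → f x ≡ g x) → sumL f xs ≡ sumL g xs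
sumL-cong [] h = refl
sumL-cong (x ∷ xs) h = cong₂ _+_ (h x) (sumL-cong xs h)

sumL-++ : ∀ {A : Set} (f : A → ℤ) xs ys → sumL f (xs List.++ ys) ≡ sumL f xs + sumL f ys
sumL-++ f [] ys = sym (ℤ.+-identityˡ _)
sumL-++ f (x ∷ xs) ys = trans (cong (f x +_) (sumL-++ f xs ys)) (sym (ℤ.+-assoc (f x) _ _))

sumL-map : ∀ {A A′ : Set} (g : A′ → ℤ) (f : A → A′) xs → sumL g (List.map f xs) ≡ sumL (λ x → g (f x)) xs
sumL-map g f [] = refl
sumL-map g f (x ∷ xs) = cong (g (f x) +_) (sumL-map g f xs)

sumL-*ˡ : ∀ {A : Set} c (f : A → ℤ) xs → sumL (λ x → c * f x) xs ≡ c * sumL f xs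
sumL-*ˡ c f [] = sym (ℤ.*-zeroʳ c)
sumL-*ˡ c f (x ∷ xs) = trans (cong (c * f x +_) (sumL-*ˡ c f xs)) (sym (ℤ.*-distribˡ-+ c (f x) _))

alternating : (Subset n → ℤ) → ℤ
alternating {n} h = sumL (λ X → sgn ∣ X ∣ * h X) (allSubsets n)

alternating-cong : ∀ {g h : Subset n → ℤ} → (∀ X → g X ≡ h X) → alternating g ≡ alternating h
alternating-cong {n} e = sumL-cong (allSubsets n) λ X → cong (sgn ∣ X ∣ *_) (e X)

alternating-suc : ∀ (h : Subset (suc n) → ℤ) →
  alternating h ≡ alternating (λ X → h (false ∷ X)) + -1ℤ * alternating (λ X → h (true ∷ X))
alternating-suc {n} h = trans (sumL-++ f (List.map (false ∷_) (allSubsets n)) _) (cong₂ _+_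
  (sumL-map f (false ∷_) (allSubsets n))
  (trans (sumL-map f (true ∷_) (allSubsets n))
    (trans (sumL-cong (allSubsets n) λ X → ℤ.*-assoc -1ℤ (sgn ∣ X ∣) (h (true ∷ X)))
      (sumL-*ˡ -1ℤ (λ X → sgn ∣ X ∣ * h (true ∷ X)) (allSubsets n)))))
  where
  f : Subset (suc n) → ℤ
  f X = sgn ∣ X ∣ * h X

-- Toggling one element reverses the parity of |X|; each element of `Z` swaps the two halves of the
-- sum and so contributes a factor -1.
alternating-△ : ∀ (h : Subset n → ℤ) Z → alternating (λ X → h (X △ Z)) ≡ sgn ∣ Z ∣ * alternating h
alternating-△ h [] = sym (ℤ.*-identityˡ _)
alternating-△ h (false ∷ Z) = begin
  alternating (λ X → h (X △ (false ∷ Z))) ≡⟨ alternating-suc (λ X → h (X △ (false ∷ Z))) ⟩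
  alternating (λ X → h₀ (X △ Z)) + -1ℤ * alternating (λ X → h₁ (X △ Z))
    ≡⟨ cong₂ (λ a b → a + -1ℤ * b) (alternating-△ h₀ Z) (alternating-△ h₁ Z) ⟩
  s * alternating h₀ + -1ℤ * (s * alternating h₁)
    ≡⟨ solve 3 (λ s a b → s :* a :+ con -1ℤ :* (s :* b) := s :* (a :+ con -1ℤ :* b)) refl
         s (alternating h₀) (alternating h₁) ⟩
  s * (alternating h₀ + -1ℤ * alternating h₁) ≡⟨ cong (s *_) (alternating-suc h) ⟨
  s * alternating h ∎
  where
  open ≡-Reasoning
  open +-*-Solver using (solve; con; _:*_; _:+_; _:=_)
  s = sgn ∣ Z ∣
  h₀ = λ X → h (false ∷ X)
  h₁ = λ X → h (true ∷ X)
alternating-△ h (true ∷ Z) = begin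
  alternating (λ X → h (X △ (true ∷ Z))) ≡⟨ alternating-suc (λ X → h (X △ (true ∷ Z))) ⟩
  alternating (λ X → h₁ (X △ Z)) + -1ℤ * alternating (λ X → h₀ (X △ Z))
    ≡⟨ cong₂ (λ a b → a + -1ℤ * b) (alternating-△ h₁ Z) (alternating-△ h₀ Z) ⟩
  s * alternating h₁ + -1ℤ * (s * alternating h₀)
    ≡⟨ solve 3 (λ s a b → s :* b :+ con -1ℤ :* (s :* a)
                            := (con -1ℤ :* s) :* (a :+ con -1ℤ :* b)) refl
         s (alternating h₀) (alternating h₁) ⟩
  (-1ℤ * s) * (alternating h₀ + -1ℤ * alternating h₁) ≡⟨ cong ((-1ℤ * s) *_) (alternating-suc h) ⟨
  (-1ℤ * s) * alternating h ∎
  where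
  open ≡-Reasoning
  open +-*-Solver using (solve; con; _:*_; _:+_; _:=_)
  s = sgn ∣ Z ∣
  h₀ = λ X → h (false ∷ X)
  h₁ = λ X → h (true ∷ X)

-- The identity of the polynomials

sgn-∸ : ∀ {m n} → m ≤ n → sgn n ≡ sgn (n ℕ.∸ m) * sgn m
sgn-∸ {m} {n} m≤n = trans (cong sgn (sym (ℕ.m∸n+n≡m m≤n))) (ℤ.^-distribˡ-+-* -1ℤ (n ℕ.∸ m) m)

-- Both polynomials reindex the same alternating sum: `penrose` complements `X`, with sign (-1)^n,
-- and `p1` toggles `X` by `Z`, with sign (-1)^|Z|. The signs differ by (-1)^(n - |Z|), and |Z| is
-- the rank.
penrose≡p1 : ∀ (M : SetSystem n) Z (G : Graph n) → (∀ Y → twist (dualPivot M (full n)) Z Y ≡ MG G Y) →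
  rankSS M ≡ ∣ Z ∣ → ∀ k → penrose M k ≡ sgn (nullity M) * p1 G k
penrose≡p1 {n} M Z G MG≡ rank≡ k = begin
  penrose M k
    ≡⟨ alternating-cong (λ X → cong (λ d → yPow d k) (dmin-dualPivot-twist M X)) ⟩
  alternating (λ X → h (X △ full n))           ≡⟨ alternating-△ h (full n) ⟩
  sgn ∣ full n ∣ * alternating h               ≡⟨ cong (λ m → sgn m * alternating h) (Sub.∣⊤∣≡n n) ⟩
  sgn n * alternating h                        ≡⟨ cong (_* alternating h) (sgn-∸ (Sub.∣p∣≤n Z)) ⟩
  sgn (n ℕ.∸ ∣ Z ∣) * sgn ∣ Z ∣ * alternating h ≡⟨ ℤ.*-assoc (sgn (n ℕ.∸ ∣ Z ∣)) _ _ ⟩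
  sgn (n ℕ.∸ ∣ Z ∣) * (sgn ∣ Z ∣ * alternating h) ≡⟨ cong₂ (λ r a → sgn (n ℕ.∸ r) * a) (sym rank≡) (sym p1≡) ⟩
  sgn (nullity M) * p1 G k                     ∎
  where
  open ≡-Reasoning
  E = dualPivot M (full n)
  h : Subset n → ℤ
  h X = yPow (dmin (twist E X)) k
  p1≡ : p1 G k ≡ sgn ∣ Z ∣ * alternating h
  p1≡ = trans
    (alternating-cong λ X → cong (λ d → yPow d k)
      (dmin-cong λ Y → trans (sym (MG≡ (Y △ X))) (cong E (△-assoc Y X Z))))
    (alternating-△ h Z)

theorem8 : (n : ℕ) (M : SetSystem n) → IsBinaryMatroid M →
    (Z : Subset n) → M Z ≡ true →
    Σ (Graph n) λ G →
    (∀ i j → G i j ≡ G j i) ×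
    (∀ Y → twist (dualPivot M (full n)) Z Y ≡ MG G Y) ×
    (∀ k → penrose M k ≡ sgn (nullity M) * p1 G k)
theorem8 n M (k , B , M≡) Z MZ = G , G-symmetric , MG≡ , penrose≡p1 M Z G MG≡ rank≡
  where
  Z-basis : colBasis B Z ≡ true
  Z-basis = trans (sym (M≡ Z)) MZ

  open Coordinates B Z Z-basis

  MG≡ : ∀ Y → twist (dualPivot M (full n)) Z Y ≡ MG G Y
  MG≡ Y = begin
    dualPivot M (full n) (Y △ Z)         ≡⟨ dualPivot≡pivot M (full n) (Y △ Z) ⟩
    pivot M (full n) (Y △ Z)             ≡⟨ pivot-select nonsingular nonsingular-xor M
                                              (λ Y → trans (M≡ Y) (colBasis≡nonsingular Y)) (Y △ Z) ⟩
    nonsingular (select α γ (Y △ Z))     ≡⟨ MG≡nonsingular Y ⟨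
    MG G Y                               ∎
    where open ≡-Reasoning

  rank≡ : rankSS M ≡ ∣ Z ∣
  rank≡ = ℕ.≤-antisym
    -- The coordinates are taken with respect to `Y` here, so the size bound is applied with `Y` and
    -- `Z` exchanged.
    (rank-≤ (allSubsets n) λ Y MY → Coordinates.basis-size-≤ B Y (trans (sym (M≡ Y)) MY) Z Z-basis)
    (rank-≥ (allSubsets n) (∈-allSubsets Z) MZ)
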